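{- For any $A\subseteq\mathbb{N}$ there exists an irreflexive interpolable relation $\prec_A$ on $\mathbb{N}$ such that for any $X\subseteq\mathbb{N}$: $A\leq_T X'$ if and only if there exists an $X$-computable relation on $\mathbb{N}$ isomorphic to $\prec_A$.
   Context: A relation $\prec$ is irreflexive if $x\prec x$ fails for all $x$. A transitive relation $\prec$ on $\mathbb{N}$ is interpolable if each initial segment $\{x\mid x\prec y\}$ is directed (non-empty, and any two of its elements have a $\prec$-upper bound in it). $X'$ denotes the Turing jump of $X$. -}

module Defs where

open import Data.Nat using (ℕ; zero; suc; _+_; _≤_; _<_; z≤n; s≤s; s≤s⁻¹)
open import Data.Nat.Properties
  using (+-comm; +-identityʳ; +-suc; suc-injective; m≤m+n; m≤n+m; ≤-trans; ≤-refl)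
open import Data.Product using (_×_; _,_; ∃-syntax; proj₁; proj₂; uncurry)
open import Level using (0ℓ)
open import Relation.Binary.Core using (Rel)
open import Relation.Binary.Definitions using (Transitive)
open import Relation.Binary.Morphism.Structures using (IsOrderIsomorphism)
open import Relation.Binary.PropositionalEquality
  using (_≡_; refl; sym; trans; cong; cong₂)
open import Relation.Nullary using (¬_)
open import Relation.Unary using (Pred)

-- The Cantor pairing ℕ × ℕ ≅ ℕ, enumerating each antidiagonal
-- (n , 0), (n - 1 , 1), …, (0 , n) in turn.

triangle : ℕ → ℕ
triangle zero    = zero
triangle (suc n) = suc n + triangle n

⟨_,_⟩ : ℕ → ℕ → ℕ
⟨ a , b ⟩ = triangle (a + b) + b

next : ℕ × ℕ → ℕ × ℕ
next (zero  , b) = suc b , zero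
next (suc a , b) = a , suc b

unpair : ℕ → ℕ × ℕ
unpair zero    = zero , zero
unpair (suc n) = next (unpair n)

π₁ π₂ : ℕ → ℕ
π₁ n = proj₁ (unpair n)
π₂ n = proj₂ (unpair n)

⟨⟩-next : ∀ p → uncurry ⟨_,_⟩ (next p) ≡ suc (uncurry ⟨_,_⟩ p)
⟨⟩-next (zero  , b) rewrite +-identityʳ b | +-identityʳ (b + triangle b)
                          = cong suc (+-comm b (triangle b))
⟨⟩-next (suc a , b) rewrite +-suc a b = +-suc (triangle (suc (a + b))) b

⟨⟩-unpair : ∀ n → ⟨ π₁ n , π₂ n ⟩ ≡ n
⟨⟩-unpair zero    = refl
⟨⟩-unpair (suc n) = trans (⟨⟩-next (unpair n)) (cong suc (⟨⟩-unpair n))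

unpair-⟨⟩ : ∀ a b → unpair ⟨ a , b ⟩ ≡ (a , b)
unpair-⟨⟩ a b = go (a + b) a b refl
  where
  go : ∀ s a b → a + b ≡ s → unpair ⟨ a , b ⟩ ≡ (a , b)
  go s zero zero _ = refl
  go (suc s) (suc a) zero eq = trans (cong unpair (⟨⟩-next (zero , a)))
    (cong next (go s zero a (trans (sym (+-identityʳ a)) (suc-injective eq))))
  go s a (suc b) eq = trans (cong unpair (⟨⟩-next (suc a , b)))
    (cong next (go s (suc a) b (trans (sym (+-suc a b)) eq)))

-- Oracle programs for the unary partial recursive functions; several
-- arguments are passed as one number through ⟨_,_⟩.

data Program : Set where
  zer succ left right oracle : Program
  pair comp prec             : Program → Program → Program
  μ                          : Program → Program

-- X ⊢ c · x ⇓ y : the program c with oracle X halts on input x with output y.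

infix 4 _⊢_·_⇓_

data _⊢_·_⇓_ (X : Pred ℕ 0ℓ) : Program → ℕ → ℕ → Set where
  zer⇓   : ∀ {x} → X ⊢ zer · x ⇓ 0
  succ⇓  : ∀ {x} → X ⊢ succ · x ⇓ suc x
  left⇓  : ∀ {x} → X ⊢ left · x ⇓ π₁ x
  right⇓ : ∀ {x} → X ⊢ right · x ⇓ π₂ x
  yes⇓   : ∀ {x} → X x → X ⊢ oracle · x ⇓ 1
  no⇓    : ∀ {x} → ¬ X x → X ⊢ oracle · x ⇓ 0
  pair⇓  : ∀ {f g x y z} → X ⊢ f · x ⇓ y → X ⊢ g · x ⇓ z →
           X ⊢ pair f g · x ⇓ ⟨ y , z ⟩
  comp⇓  : ∀ {f g x y z} → X ⊢ g · x ⇓ y → X ⊢ f · y ⇓ z →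
           X ⊢ comp f g · x ⇓ z
  prec₀⇓ : ∀ {f g a y} → X ⊢ f · a ⇓ y →
           X ⊢ prec f g · ⟨ a , zero ⟩ ⇓ y
  precₛ⇓ : ∀ {f g a n y z} → X ⊢ prec f g · ⟨ a , n ⟩ ⇓ y →
           X ⊢ g · ⟨ a , ⟨ n , y ⟩ ⟩ ⇓ z →
           X ⊢ prec f g · ⟨ a , suc n ⟩ ⇓ z
  μ⇓     : ∀ {f a n} → X ⊢ f · ⟨ a , n ⟩ ⇓ 0 →
           (∀ m → m < n → ∃[ v ] X ⊢ f · ⟨ a , m ⟩ ⇓ suc v) →
           X ⊢ μ f · a ⇓ n

-- Gödel numbering.  An index is a constructor tag paired with the indices of
-- the subprograms.  These are smaller than the whole, so the index itself is
-- enough fuel; tags above 8 are read as 8, so every number is an index.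

decodeWithin : ℕ → ℕ → Program
decodeWithin zero       e = zer
decodeWithin (suc fuel) e with unpair e
... | 0 , r = zer
... | 1 , r = succ
... | 2 , r = left
... | 3 , r = right
... | 4 , r = oracle
... | 5 , r = pair (decodeWithin fuel (π₁ r)) (decodeWithin fuel (π₂ r))
... | 6 , r = comp (decodeWithin fuel (π₁ r)) (decodeWithin fuel (π₂ r))
... | 7 , r = prec (decodeWithin fuel (π₁ r)) (decodeWithin fuel (π₂ r))
... | _ , r = μ (decodeWithin fuel r)

decode : ℕ → Program
decode e = decodeWithin e e

encode : Program → ℕ
encode zer        = ⟨ 0 , 0 ⟩
encode succ       = ⟨ 1 , 0 ⟩
encode left       = ⟨ 2 , 0 ⟩
encode right      = ⟨ 3 , 0 ⟩
encode oracle     = ⟨ 4 , 0 ⟩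
encode (pair f g) = ⟨ 5 , ⟨ encode f , encode g ⟩ ⟩
encode (comp f g) = ⟨ 6 , ⟨ encode f , encode g ⟩ ⟩
encode (prec f g) = ⟨ 7 , ⟨ encode f , encode g ⟩ ⟩
encode (μ f)      = ⟨ 8 , encode f ⟩

n≤triangle : ∀ n → n ≤ triangle n
n≤triangle zero    = z≤n
n≤triangle (suc n) = m≤m+n (suc n) (triangle n)

fst≤⟨⟩ : ∀ a b → a ≤ ⟨ a , b ⟩
fst≤⟨⟩ a b = ≤-trans (m≤m+n a b) (≤-trans (n≤triangle (a + b)) (m≤m+n _ b))

snd≤⟨⟩ : ∀ a b → b ≤ ⟨ a , b ⟩
snd≤⟨⟩ a b = m≤n+m b (triangle (a + b))

snd<⟨suc⟩ : ∀ a b → b < ⟨ suc a , b ⟩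
snd<⟨suc⟩ a b = s≤s (m≤n+m b (a + b + triangle (a + b)))

decodeWithin-encode : ∀ c {fuel} → encode c ≤ fuel → decodeWithin fuel (encode c) ≡ c
decodeWithin-encode₂ : ∀ f g t {fuel} → ⟨ suc t , ⟨ encode f , encode g ⟩ ⟩ ≤ suc fuel →
  decodeWithin fuel (π₁ ⟨ encode f , encode g ⟩) ≡ f ×
  decodeWithin fuel (π₂ ⟨ encode f , encode g ⟩) ≡ g

decodeWithin-encode zer    {zero}  _ = refl
decodeWithin-encode zer    {suc _} _ = refl
decodeWithin-encode succ   {suc _} _ = refl
decodeWithin-encode left   {suc _} _ = refl
decodeWithin-encode right  {suc _} _ = refl
decodeWithin-encode oracle {suc _} _ = refl
decodeWithin-encode (pair f g) {suc _} p
  rewrite unpair-⟨⟩ 5 ⟨ encode f , encode g ⟩ = uncurry (cong₂ pair) (decodeWithin-encode₂ f g 4 p)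
decodeWithin-encode (comp f g) {suc _} p
  rewrite unpair-⟨⟩ 6 ⟨ encode f , encode g ⟩ = uncurry (cong₂ comp) (decodeWithin-encode₂ f g 5 p)
decodeWithin-encode (prec f g) {suc _} p
  rewrite unpair-⟨⟩ 7 ⟨ encode f , encode g ⟩ = uncurry (cong₂ prec) (decodeWithin-encode₂ f g 6 p)
decodeWithin-encode (μ f) {suc _} p
  rewrite unpair-⟨⟩ 8 (encode f) =
  cong μ (decodeWithin-encode f (s≤s⁻¹ (≤-trans (snd<⟨suc⟩ 7 (encode f)) p)))

decodeWithin-encode₂ f g t p rewrite unpair-⟨⟩ (encode f) (encode g) =
  decodeWithin-encode f (≤-trans (fst≤⟨⟩ (encode f) (encode g)) r≤fuel) ,
  decodeWithin-encode g (≤-trans (snd≤⟨⟩ (encode f) (encode g)) r≤fuel)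
  where r≤fuel = s≤s⁻¹ (≤-trans (snd<⟨suc⟩ t ⟨ encode f , encode g ⟩) p)

decode-encode : ∀ c → decode (encode c) ≡ c
decode-encode c = decodeWithin-encode c ≤-refl

infix 4 _≤T_
infix 8 _′
infix 4 _-computable_ _≅_

_≤T_ : Rel (Pred ℕ 0ℓ) 0ℓ
A ≤T X = ∃[ c ] ∀ x → (A x → X ⊢ c · x ⇓ 1) × (¬ A x → X ⊢ c · x ⇓ 0)

_′ : Pred ℕ 0ℓ → Pred ℕ 0ℓ
(X ′) e = ∃[ y ] X ⊢ decode e · e ⇓ y

_-computable_ : Pred ℕ 0ℓ → Rel ℕ 0ℓ → Set
X -computable _≺_ = (λ z → π₁ z ≺ π₂ z) ≤T X

record Interpolable (_≺_ : Rel ℕ 0ℓ) : Set where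
  field
    transitive : Transitive _≺_
    nonempty   : ∀ y → ∃[ x ] x ≺ y
    directed   : ∀ {y a b} → a ≺ y → b ≺ y → ∃[ c ] c ≺ y × a ≺ c × b ≺ c

_≅_ : Rel (Rel ℕ 0ℓ) 0ℓ
_≺₁_ ≅ _≺₂_ = ∃[ f ] IsOrderIsomorphism _≡_ _≡_ _≺₁_ _≺₂_ f

{-# OPTIONS --safe #-}
module Submission where

-- The set Join A, a version of A ⊕ ∁ A, is Σ₂ in X iff A ≤T X ′, and the
-- order codes it by the sizes of antichains.  It is a disjoint union of
-- components, each a copy of the positive rationals with an antichain of tops
-- above it; for k in Join A infinitely many components have exactly k + 1
-- tops, and infinitely many components have infinitely many.  That an
-- antichain has exactly k + 1 elements is a Π₁ statement about a given list of
-- points, so a search with oracle X ′ through the lists recovers A from any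
-- X-computable copy.  Conversely let k ∈ Join A iff ∃ W ∀ t R k W t with R
-- computable in X: the component of (k , W) starts with k + 1 tops and gets
-- infinitely many more once some R k W t fails.  The orders obtained from A
-- and from X have the same sizes, each infinitely often, so they are
-- isomorphic.

open import Defs
open import Axiom.ExcludedMiddle using (ExcludedMiddle)
open import Data.Empty using (⊥; ⊥-elim)
open import Data.Fin using (Fin; zero; suc; #_; fromℕ<; toℕ)
open import Data.Fin.Properties using (injective⇒≤; toℕ-injective; toℕ<n; fromℕ<-injective)
open import Data.List.Base using (List; []; _∷_; _++_; length)
open import Data.List.Membership.Propositional using (_∈_)
open import Data.List.Membership.Propositional.Properties using (∈-++⁺ˡ; ∈-++⁺ʳ)
open import Data.List.Relation.Unary.Any using (here; there)
open import Data.Nat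
open import Data.Nat.Properties
open import Data.Nat.Solver using (module +-*-Solver)
open import Data.Product using (_×_; _,_; ∃; ∃-syntax; ∃₂; proj₁; proj₂)
open import Data.Sum using (_⊎_; inj₁; inj₂)
open import Data.Vec.Base using (Vec; []; _∷_; lookup)
open import Function.Bundles using (_⇔_; mk⇔; Equivalence)
open import Function.Definitions using (Injective; StrictlySurjective)
open import Level using (0ℓ)
open import Relation.Binary.Core using (Rel)
open import Relation.Binary.Definitions using (Irreflexive; Transitive; tri<; tri≈; tri>)
open import Relation.Binary.Morphism.Structures using (IsOrderIsomorphism)
open import Relation.Binary.PropositionalEquality
open import Relation.Nullary using (¬_; Dec; yes; no)
open import Relation.Unary using (Pred)

open Equivalence using (to; from)

-- The coding must survive mistakes. With oracle X the statement that all R k W t hold can only be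
-- refuted, and by then some tops have been put in for good. A refuted component is therefore given
-- infinitely many tops; that size carries no information, because `Join A` is never all of ℕ and so
-- it always occurs. How often the other sizes occur depends on the number of witnesses W, so every
-- component is duplicated infinitely often and only the set of sizes remains as an invariant. Such
-- a set codes a Σ₂ condition, whereas A ≤T X ′ is Δ₂: hence the join of A with its complement.
-- Irreflexivity and non-empty initial segments exclude finite components, so the information sits
-- in the maximal points, and a dense order below them supplies directedness and marks which tops
-- belong together. The rationals are repeated so that a point that is not a top has infinitely many
-- incomparable neighbours and cannot imitate a small antichain. R itself comes from a normal form:
-- a computation is a list of facts, checking the list is a bounded formula, and bounded formulas
-- compile to programs.

-- Programs for arithmetic and for bounded formulas

-- The pairing, made opaque so that unification treats it as injective.
opaque
  ⟪_,_⟫ : ℕ → ℕ → ℕ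
  ⟪ a , b ⟫ = ⟨ a , b ⟩

  ⟪⟫≡⟨⟩ : ∀ {a b} → ⟪ a , b ⟫ ≡ ⟨ a , b ⟩
  ⟪⟫≡⟨⟩ = refl

  π₁-⟪⟫ : ∀ {a b} → π₁ ⟪ a , b ⟫ ≡ a
  π₁-⟪⟫ {a} {b} = cong proj₁ (unpair-⟨⟩ a b)

  π₂-⟪⟫ : ∀ {a b} → π₂ ⟪ a , b ⟫ ≡ b
  π₂-⟪⟫ {a} {b} = cong proj₂ (unpair-⟨⟩ a b)

  ⟪⟫-η : ∀ n → ⟪ π₁ n , π₂ n ⟫ ≡ n
  ⟪⟫-η = ⟨⟩-unpair

  pair⟪⟫⇓ : ∀ {X f g x y z} → X ⊢ f · x ⇓ y → X ⊢ g · x ⇓ z →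
            X ⊢ pair f g · x ⇓ ⟪ y , z ⟫
  pair⟪⟫⇓ = pair⇓

  prec₀⟪⟫⇓ : ∀ {X f g a y} → X ⊢ f · a ⇓ y → X ⊢ prec f g · ⟪ a , 0 ⟫ ⇓ y
  prec₀⟪⟫⇓ {a = a} = prec₀⇓ {a = a}

  precₛ⟪⟫⇓ : ∀ {X f g a n y z} → X ⊢ prec f g · ⟪ a , n ⟫ ⇓ y →
             X ⊢ g · ⟪ a , ⟪ n , y ⟫ ⟫ ⇓ z →
             X ⊢ prec f g · ⟪ a , suc n ⟫ ⇓ z
  precₛ⟪⟫⇓ {a = a} {n} = precₛ⇓ {a = a} {n}

  μ⟪⟫⇓ : ∀ {X f a n} → X ⊢ f · ⟪ a , n ⟫ ⇓ 0 →
         (∀ m → m < n → ∃[ v ] X ⊢ f · ⟪ a , m ⟫ ⇓ suc v) → X ⊢ μ f · a ⇓ n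
  μ⟪⟫⇓ = μ⇓

⟪⟫-injective : ∀ {a b c d} → ⟪ a , b ⟫ ≡ ⟪ c , d ⟫ → a ≡ c × b ≡ d
⟪⟫-injective eq =
  trans (sym π₁-⟪⟫) (trans (cong π₁ eq) π₁-⟪⟫) ,
  trans (sym π₂-⟪⟫) (trans (cong π₂ eq) π₂-⟪⟫)

identity parameter index value plus times predecessor monus isZero : Program
identity  = pair left right
parameter = left
index     = comp left right
value     = comp right right
plus      = prec identity (comp succ value)
times     = prec zer (comp plus (pair value parameter))
predecessor = comp (prec zer index) (pair zer identity)
monus     = prec identity (comp predecessor value)

constant : ℕ → Program
constant zero    = zer
constant (suc n) = comp succ (constant n)

isZero = comp (prec (constant 1) zer) (pair zer identity)

entries : Program
entries = prec identity (comp right value)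

-- Every number is read as an infinite sequence by iterated unpairing, so a lookup never fails;
-- lengths are recorded separately.
drop : ℕ → ℕ → ℕ
drop zero    w = w
drop (suc j) w = π₂ (drop j w)

nth : ℕ → ℕ → ℕ
nth w j = π₁ (drop j w)

⊢nth : Program
⊢nth = comp left entries

-- The 0/1 answers of `c` are multiplied. The index is passed in front of the parameter because
-- `⟪ i , a ⟫` is then the environment extended by the bound variable.
boundedAll : Program → Program
boundedAll c = prec (constant 1) (comp times (pair value (comp c (pair index parameter))))

isZeroℕ : ℕ → ℕ
isZeroℕ zero    = 1
isZeroℕ (suc _) = 0

module _ {X : Pred ℕ 0ℓ} where

  cast⇓ : ∀ {c x y z} → y ≡ z → X ⊢ c · x ⇓ y → X ⊢ c · x ⇓ z
  cast⇓ refl d = d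

  left⟪⟫⇓ : ∀ {a b} → X ⊢ left · ⟪ a , b ⟫ ⇓ a
  left⟪⟫⇓ {a} {b} = cast⇓ π₁-⟪⟫ left⇓

  right⟪⟫⇓ : ∀ {a b} → X ⊢ right · ⟪ a , b ⟫ ⇓ b
  right⟪⟫⇓ {a} {b} = cast⇓ π₂-⟪⟫ right⇓

  identity⇓ : ∀ {x} → X ⊢ identity · x ⇓ x
  identity⇓ {x} = cast⇓ (⟪⟫-η x) (pair⟪⟫⇓ (left⇓ {x = x}) (right⇓ {x = x}))

  index⇓ : ∀ {a n y} → X ⊢ index · ⟪ a , ⟪ n , y ⟫ ⟫ ⇓ n
  index⇓ = comp⇓ right⟪⟫⇓ left⟪⟫⇓

  value⇓ : ∀ {a n y} → X ⊢ value · ⟪ a , ⟪ n , y ⟫ ⟫ ⇓ y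
  value⇓ = comp⇓ right⟪⟫⇓ right⟪⟫⇓

  constant⇓ : ∀ n {x} → X ⊢ constant n · x ⇓ n
  constant⇓ zero    = zer⇓
  constant⇓ (suc n) = comp⇓ (constant⇓ n) succ⇓

  prec⇓ : ∀ {f g a} (F : ℕ → ℕ) → X ⊢ f · a ⇓ F 0 →
          (∀ n → X ⊢ g · ⟪ a , ⟪ n , F n ⟫ ⟫ ⇓ F (suc n)) →
          ∀ n → X ⊢ prec f g · ⟪ a , n ⟫ ⇓ F n
  prec⇓ F base step zero    = prec₀⟪⟫⇓ base
  prec⇓ F base step (suc n) = precₛ⟪⟫⇓ (prec⇓ F base step n) (step n)

  plus⇓ : ∀ a n → X ⊢ plus · ⟪ a , n ⟫ ⇓ n + a
  plus⇓ a = prec⇓ (_+ a) identity⇓ (λ n → comp⇓ value⇓ succ⇓)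

  times⇓ : ∀ a n → X ⊢ times · ⟪ a , n ⟫ ⇓ n * a
  times⇓ a = prec⇓ (_* a) zer⇓ (λ n → comp⇓ (pair⟪⟫⇓ value⇓ left⟪⟫⇓) (plus⇓ (n * a) a))

  predecessor⇓ : ∀ n → X ⊢ predecessor · n ⇓ pred n
  predecessor⇓ n =
    comp⇓ (pair⟪⟫⇓ zer⇓ identity⇓) (prec⇓ pred zer⇓ (λ m → index⇓) n)

  monus⇓ : ∀ a n → X ⊢ monus · ⟪ a , n ⟫ ⇓ a ∸ n
  monus⇓ a = prec⇓ (a ∸_) identity⇓
    (λ n → cast⇓ (pred[m∸n]≡m∸[1+n] a n) (comp⇓ value⇓ (predecessor⇓ (a ∸ n))))

  isZero⇓ : ∀ n → X ⊢ isZero · n ⇓ isZeroℕ n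
  isZero⇓ n = comp⇓ (pair⟪⟫⇓ zer⇓ identity⇓)
    (prec⇓ isZeroℕ (constant⇓ 1) (λ m → zer⇓) n)

  nth⇓ : ∀ w j → X ⊢ ⊢nth · ⟪ w , j ⟫ ⇓ nth w j
  nth⇓ w j = comp⇓
    (prec⇓ (λ i → drop i w) identity⇓ (λ i → comp⇓ value⇓ (right⇓ {x = drop i w})) j)
    (left⇓ {x = drop j w})

-- Bounded formulas and their compilation

infix  8 _⊗_
infix  7 _≐_ _≺̇_
infix  6 ¬̇_
infixr 5 _∧̇_
infixr 4 _∨̇_

data Term (n : ℕ) : Set where
  var           : Fin n → Term n
  lit           : ℕ → Term n
  sucᵗ fst snd  : Term n → Term n
  pr _⊗_ entry  : Term n → Term n → Term n

-- Arithmetical formulas with bounded quantifiers and one unary relation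
-- symbol; variable 0 is the innermost.
data Formula (n : ℕ) : Set where
  rel            : Term n → Formula n
  _≐_ _≺̇_        : Term n → Term n → Formula n
  ¬̇_             : Formula n → Formula n
  _∧̇_ _∨̇_        : Formula n → Formula n → Formula n
  all< ex<       : Term n → Formula (suc n) → Formula n
  substitute     : ∀ {m} → Formula m → Vec (Term n) m → Formula n

eval : ∀ {n} → Vec ℕ n → Term n → ℕ
eval ρ (var i)     = lookup ρ i
eval ρ (lit k)     = k
eval ρ (sucᵗ t)    = suc (eval ρ t)
eval ρ (fst t)     = π₁ (eval ρ t)
eval ρ (snd t)     = π₂ (eval ρ t)
eval ρ (pr t u)    = ⟪ eval ρ t , eval ρ u ⟫
eval ρ (t ⊗ u)     = eval ρ t * eval ρ u
eval ρ (entry t u) = nth (eval ρ t) (eval ρ u)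

evals : ∀ {n m} → Vec ℕ n → Vec (Term n) m → Vec ℕ m
evals ρ []       = []
evals ρ (t ∷ ts) = eval ρ t ∷ evals ρ ts

module _ (P : Pred ℕ 0ℓ) where

  Holds : ∀ {n} → Vec ℕ n → Formula n → Set
  Holds ρ (rel t)           = P (eval ρ t)
  Holds ρ (t ≐ u)           = eval ρ t ≡ eval ρ u
  Holds ρ (t ≺̇ u)           = eval ρ t < eval ρ u
  Holds ρ (¬̇ φ)             = ¬ Holds ρ φ
  Holds ρ (φ ∧̇ ψ)           = Holds ρ φ × Holds ρ ψ
  Holds ρ (φ ∨̇ ψ)           = Holds ρ φ ⊎ Holds ρ ψ
  Holds ρ (all< t φ)        = ∀ i → i < eval ρ t → Holds (i ∷ ρ) φ
  Holds ρ (ex< t φ)         = ∃ λ i → i < eval ρ t × Holds (i ∷ ρ) φ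
  Holds ρ (substitute φ ts) = Holds (evals ρ ts) φ

environment : ∀ {n} → Vec ℕ n → ℕ
environment []      = 0
environment (x ∷ ρ) = ⟪ x , environment ρ ⟫

access : ∀ {n} → Fin n → Program
access zero    = left
access (suc i) = comp (access i) right

compileTerm : ∀ {n} → Term n → Program
compileTerm (var i)     = access i
compileTerm (lit k)     = constant k
compileTerm (sucᵗ t)    = comp succ (compileTerm t)
compileTerm (fst t)     = comp left (compileTerm t)
compileTerm (snd t)     = comp right (compileTerm t)
compileTerm (pr t u)    = pair (compileTerm t) (compileTerm u)
compileTerm (t ⊗ u)     = comp times (pair (compileTerm u) (compileTerm t))
compileTerm (entry t u) = comp ⊢nth (pair (compileTerm t) (compileTerm u))

-- Substitution is explicit in formulas: the new environment is built at run time, so correctness is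
-- a mere composition of programs.
compileTerms : ∀ {n m} → Vec (Term n) m → Program
compileTerms []       = zer
compileTerms (t ∷ ts) = pair (compileTerm t) (compileTerms ts)

negate : Program → Program
negate c = comp isZero c

conjoin : Program → Program → Program
conjoin c d = comp times (pair c d)

module _ (decider : Program) where

  compile : ∀ {n} → Formula n → Program
  compile (rel t)           = comp decider (compileTerm t)
  compile (t ≺̇ u)           = negate (comp monus (pair (comp succ (compileTerm t)) (compileTerm u)))
  compile (t ≐ u)           = conjoin
    (negate (comp monus (pair (compileTerm u) (compileTerm t))))
    (negate (comp monus (pair (compileTerm t) (compileTerm u))))
  compile (¬̇ φ)             = negate (compile φ)
  compile (φ ∧̇ ψ)           = conjoin (compile φ) (compile ψ)
  compile (φ ∨̇ ψ)           = negate (conjoin (negate (compile φ)) (negate (compile ψ)))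
  compile (all< t φ)        = comp (boundedAll (compile φ)) (pair identity (compileTerm t))
  compile (ex< t φ)         =
    negate (comp (boundedAll (negate (compile φ))) (pair identity (compileTerm t)))
  compile (substitute φ ts) = comp (compile φ) (compileTerms ts)

module _ {X : Pred ℕ 0ℓ} where

  access⇓ : ∀ {n} (ρ : Vec ℕ n) i → X ⊢ access i · environment ρ ⇓ lookup ρ i
  access⇓ (x ∷ ρ) zero    = left⟪⟫⇓
  access⇓ (x ∷ ρ) (suc i) = comp⇓ right⟪⟫⇓ (access⇓ ρ i)

  compileTerm⇓ : ∀ {n} (ρ : Vec ℕ n) t →
                 X ⊢ compileTerm t · environment ρ ⇓ eval ρ t
  compileTerm⇓ ρ (var i)     = access⇓ ρ i
  compileTerm⇓ ρ (lit k)     = constant⇓ k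
  compileTerm⇓ ρ (sucᵗ t)    = comp⇓ (compileTerm⇓ ρ t) succ⇓
  compileTerm⇓ ρ (fst t)     = comp⇓ (compileTerm⇓ ρ t) left⇓
  compileTerm⇓ ρ (snd t)     = comp⇓ (compileTerm⇓ ρ t) right⇓
  compileTerm⇓ ρ (pr t u)    = pair⟪⟫⇓ (compileTerm⇓ ρ t) (compileTerm⇓ ρ u)
  compileTerm⇓ ρ (t ⊗ u)     =
    comp⇓ (pair⟪⟫⇓ (compileTerm⇓ ρ u) (compileTerm⇓ ρ t)) (times⇓ (eval ρ u) (eval ρ t))
  compileTerm⇓ ρ (entry t u) =
    comp⇓ (pair⟪⟫⇓ (compileTerm⇓ ρ t) (compileTerm⇓ ρ u)) (nth⇓ (eval ρ t) (eval ρ u))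

  compileTerms⇓ : ∀ {n m} (ρ : Vec ℕ n) (ts : Vec (Term n) m) →
                  X ⊢ compileTerms ts · environment ρ ⇓ environment (evals ρ ts)
  compileTerms⇓ ρ []       = zer⇓
  compileTerms⇓ ρ (t ∷ ts) = pair⟪⟫⇓ (compileTerm⇓ ρ t) (compileTerms⇓ ρ ts)

infix 4 _⊢_·_⇓?_

_⊢_·_⇓?_ : Pred ℕ 0ℓ → Program → ℕ → Set → Set
X ⊢ c · x ⇓? P = (P → X ⊢ c · x ⇓ 1) × (¬ P → X ⊢ c · x ⇓ 0)

module Classical (em : ExcludedMiddle 0ℓ) where

  stable : ∀ {P : Set} → ¬ ¬ P → P
  stable {P} ¬¬p with em {P}
  ... | yes p = p
  ... | no ¬p = ⊥-elim (¬¬p ¬p)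

  counterexample : ∀ {P : ℕ → Set} → ¬ (∀ n → P n) → ∃ λ n → ¬ P n
  counterexample ¬all = stable (λ none → ¬all (λ n → stable (λ ¬p → none (n , ¬p))))

  module _ {X : Pred ℕ 0ℓ} where

    decide-⇔ : ∀ {c x P Q} → P ⇔ Q → X ⊢ c · x ⇓? P → X ⊢ c · x ⇓? Q
    decide-⇔ e (d₁ , d₀) = (λ q → d₁ (from e q)) , (λ ¬q → d₀ (λ p → ¬q (to e p)))

    decide-¬ : ∀ {c x P} → X ⊢ c · x ⇓? P → X ⊢ negate c · x ⇓? (¬ P)
    decide-¬ (d₁ , d₀) =
      (λ ¬p → comp⇓ (d₀ ¬p) (isZero⇓ 0)) ,
      (λ ¬¬p → comp⇓ (d₁ (stable ¬¬p)) (isZero⇓ 1))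

    decide-× : ∀ {c d x P Q} → X ⊢ c · x ⇓? P → X ⊢ d · x ⇓? Q →
               X ⊢ conjoin c d · x ⇓? (P × Q)
    decide-× {c} {d} {x} {P} {Q} (c₁ , c₀) (d₁ , d₀) =
      (λ (p , q) → comp⇓ (pair⟪⟫⇓ (c₁ p) (d₁ q)) (times⇓ 1 1)) , refute
      where
      refute : ¬ (P × Q) → X ⊢ conjoin c d · x ⇓ 0
      refute ¬pq with em {P} | em {Q}
      ... | yes p | yes q = ⊥-elim (¬pq (p , q))
      ... | yes p | no ¬q = comp⇓ (pair⟪⟫⇓ (c₁ p) (d₀ ¬q)) (times⇓ 1 0)
      ... | no ¬p | yes q = comp⇓ (pair⟪⟫⇓ (c₀ ¬p) (d₁ q)) (times⇓ 0 1)
      ... | no ¬p | no ¬q = comp⇓ (pair⟪⟫⇓ (c₀ ¬p) (d₀ ¬q)) (times⇓ 0 0)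

    boundedAll-suc⇓ : ∀ {c a n p q} → X ⊢ boundedAll c · ⟪ a , n ⟫ ⇓ p → X ⊢ c · ⟪ n , a ⟫ ⇓ q →
                      X ⊢ boundedAll c · ⟪ a , suc n ⟫ ⇓ q * p
    boundedAll-suc⇓ {p = p} {q} d e = precₛ⟪⟫⇓ d
      (comp⇓ (pair⟪⟫⇓ value⇓ (comp⇓ (pair⟪⟫⇓ index⇓ left⟪⟫⇓) e)) (times⇓ p q))

    decide-all : ∀ {c a} {P : ℕ → Set} → (∀ i → X ⊢ c · ⟪ i , a ⟫ ⇓? P i) →
                 ∀ n → X ⊢ boundedAll c · ⟪ a , n ⟫ ⇓? (∀ i → i < n → P i)
    decide-all d zero = (λ _ → prec₀⟪⟫⇓ (constant⇓ 1)) , (λ ¬all → ⊥-elim (¬all (λ _ ())))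
    decide-all {c} {a} {P} d (suc n)
      with em {∀ i → i < n → P i} | em {P n} | decide-all d n
    ... | yes all | yes p | h =
      (λ _ → boundedAll-suc⇓ (proj₁ h all) (proj₁ (d n) p)) ,
      (λ ¬all → ⊥-elim (¬all (extend all p)))
      where
      extend : (∀ i → i < n → P i) → P n → ∀ i → i < suc n → P i
      extend all p i i<1+n with m<1+n⇒m<n∨m≡n i<1+n
      ... | inj₁ i<n  = all i i<n
      ... | inj₂ refl = p
    ... | yes all | no ¬p | h =
      (λ all' → ⊥-elim (¬p (all' n ≤-refl))) ,
      (λ _ → boundedAll-suc⇓ (proj₁ h all) (proj₂ (d n) ¬p))
    ... | no ¬all | yes p | h =
      (λ all → ⊥-elim (¬all (λ i i<n → all i (m<n⇒m<1+n i<n)))) ,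
      (λ _ → boundedAll-suc⇓ (proj₂ h ¬all) (proj₁ (d n) p))
    ... | no ¬all | no ¬p | h =
      (λ all → ⊥-elim (¬all (λ i i<n → all i (m<n⇒m<1+n i<n)))) ,
      (λ _ → boundedAll-suc⇓ (proj₂ h ¬all) (proj₂ (d n) ¬p))

    decide-≤ : ∀ {c d x m n} → X ⊢ c · x ⇓ m → X ⊢ d · x ⇓ n →
               X ⊢ negate (comp monus (pair c d)) · x ⇓? (m ≤ n)
    decide-≤ {c} {d} {x} {m} {n} p q =
      (λ m≤n → run (m≤n⇒m∸n≡0 m≤n)) , λ m≰n → run' (m ∸ n) refl (λ eq → m≰n (m∸n≡0⇒m≤n eq))
      where
      difference : X ⊢ comp monus (pair c d) · x ⇓ m ∸ n
      difference = comp⇓ (pair⟪⟫⇓ p q) (monus⇓ m n)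
      run : m ∸ n ≡ 0 → X ⊢ negate (comp monus (pair c d)) · x ⇓ 1
      run eq = comp⇓ (cast⇓ eq difference) (isZero⇓ 0)
      run' : ∀ k → m ∸ n ≡ k → m ∸ n ≢ 0 → X ⊢ negate (comp monus (pair c d)) · x ⇓ 0
      run' zero    eq ≢0 = ⊥-elim (≢0 eq)
      run' (suc k) eq _  = comp⇓ (cast⇓ eq difference) (isZero⇓ (suc k))

    module _ {P : Pred ℕ 0ℓ} (P≤X : P ≤T X) where

      compile⇓ : ∀ {n} (ρ : Vec ℕ n) φ →
                 X ⊢ compile (proj₁ P≤X) φ · environment ρ ⇓? Holds P ρ φ
      compile⇓ ρ (rel t) =
        (λ h → comp⇓ (compileTerm⇓ ρ t) (proj₁ (proj₂ P≤X (eval ρ t)) h)) ,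
        (λ h → comp⇓ (compileTerm⇓ ρ t) (proj₂ (proj₂ P≤X (eval ρ t)) h))
      compile⇓ ρ (t ≺̇ u) = decide-≤ (comp⇓ (compileTerm⇓ ρ t) succ⇓) (compileTerm⇓ ρ u)
      compile⇓ ρ (t ≐ u) = decide-⇔
        (mk⇔ (λ (u≤t , t≤u) → ≤-antisym t≤u u≤t)
             (λ eq → ≤-reflexive (sym eq) , ≤-reflexive eq))
        (decide-× (decide-≤ (compileTerm⇓ ρ u) (compileTerm⇓ ρ t))
                  (decide-≤ (compileTerm⇓ ρ t) (compileTerm⇓ ρ u)))
      compile⇓ ρ (¬̇ φ) = decide-¬ (compile⇓ ρ φ)
      compile⇓ ρ (φ ∧̇ ψ) = decide-× (compile⇓ ρ φ) (compile⇓ ρ ψ)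
      compile⇓ ρ (φ ∨̇ ψ) = decide-⇔
        (mk⇔ disjunct (λ { (inj₁ p) (¬p , _) → ¬p p ; (inj₂ q) (_ , ¬q) → ¬q q }))
        (decide-¬ (decide-× (decide-¬ (compile⇓ ρ φ)) (decide-¬ (compile⇓ ρ ψ))))
        where
        disjunct : ¬ (¬ Holds P ρ φ × ¬ Holds P ρ ψ) → Holds P ρ φ ⊎ Holds P ρ ψ
        disjunct h with em {Holds P ρ φ}
        ... | yes p = inj₁ p
        ... | no ¬p = inj₂ (stable (λ ¬q → h (¬p , ¬q)))
      compile⇓ ρ (all< t φ) =
        let (d₁ , d₀) = decide-all (λ i → compile⇓ (i ∷ ρ) φ) (eval ρ t)
            bound     = pair⟪⟫⇓ identity⇓ (compileTerm⇓ ρ t)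
        in (λ h → comp⇓ bound (d₁ h)) , (λ h → comp⇓ bound (d₀ h))
      compile⇓ ρ (ex< t φ) = decide-⇔
        (mk⇔ (λ h → stable (λ none → h (λ i i<n p → none (i , i<n , p))))
             (λ (i , i<n , p) h → h i i<n p))
        (decide-¬ ((λ h → comp⇓ bound (d₁ h)) , (λ h → comp⇓ bound (d₀ h))))
        where
        bound = pair⟪⟫⇓ identity⇓ (compileTerm⇓ ρ t)
        d₁ = proj₁ (decide-all (λ i → decide-¬ (compile⇓ (i ∷ ρ) φ)) (eval ρ t))
        d₀ = proj₂ (decide-all (λ i → decide-¬ (compile⇓ (i ∷ ρ) φ)) (eval ρ t))
      compile⇓ ρ (substitute φ ts) =
        (λ h → comp⇓ (compileTerms⇓ ρ ts) (proj₁ (compile⇓ (evals ρ ts) φ) h)) ,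
        (λ h → comp⇓ (compileTerms⇓ ρ ts) (proj₂ (compile⇓ (evals ρ ts) φ) h))

      definable⇒≤T : (φ : Formula 1) → (λ z → Holds P (z ∷ []) φ) ≤T X
      definable⇒≤T φ = comp (compile (proj₁ P≤X) φ) (pair identity zer) , λ z →
        (λ h → comp⇓ (pair⟪⟫⇓ identity⇓ zer⇓) (proj₁ (compile⇓ (z ∷ []) φ) h)) ,
        (λ h → comp⇓ (pair⟪⟫⇓ identity⇓ zer⇓) (proj₂ (compile⇓ (z ∷ []) φ) h))

-- Determinism and derivations

⟨⟩-injective : ∀ {a b c d} → ⟨ a , b ⟩ ≡ ⟨ c , d ⟩ → a ≡ c × b ≡ d
⟨⟩-injective eq = ⟪⟫-injective (trans (⟪⟫≡⟨⟩) (trans eq (sym ⟪⟫≡⟨⟩)))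

module _ {X : Pred ℕ 0ℓ} where

  -- The input `⟨ a , n ⟩` of a `prec` computation is a sum that unification cannot invert. The view
  -- allows a variable input together with an equation, which `⟨⟩-injective` then solves or refutes.
  data PrecView (f g : Program) : ℕ → ℕ → Set where
    at-zero : ∀ {a z} → X ⊢ f · a ⇓ z → PrecView f g ⟨ a , 0 ⟩ z
    at-suc  : ∀ {a n y z} → X ⊢ prec f g · ⟨ a , n ⟩ ⇓ y → X ⊢ g · ⟨ a , ⟨ n , y ⟩ ⟩ ⇓ z →
           PrecView f g ⟨ a , suc n ⟩ z

  precView : ∀ {f g x z} → X ⊢ prec f g · x ⇓ z → PrecView f g x z
  precView (prec₀⇓ {a = a} d)            = at-zero {a = a} d
  precView (precₛ⇓ {a = a} {n} {y} d d') = at-suc {a = a} {n} {y} d d'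

  precView₀ : ∀ {f g a x z} → PrecView f g x z → x ≡ ⟨ a , 0 ⟩ → X ⊢ f · a ⇓ z
  precView₀ {a = a} (at-zero {a = a'} d) eq with ⟨⟩-injective {a'} {0} {a} {0} eq
  ... | refl , _ = d
  precView₀ {a = a} (at-suc {a'} {n} _ _) eq with ⟨⟩-injective {a'} {suc n} {a} {0} eq
  ... | _ , ()

  precViewₛ : ∀ {f g a n x z} → PrecView f g x z → x ≡ ⟨ a , suc n ⟩ →
              ∃ λ y → X ⊢ prec f g · ⟨ a , n ⟩ ⇓ y × X ⊢ g · ⟨ a , ⟨ n , y ⟩ ⟩ ⇓ z
  precViewₛ {a = a} {n} (at-zero {a = a'} d) eq with ⟨⟩-injective {a'} {0} {a} {suc n} eq
  ... | _ , ()
  precViewₛ {a = a} {n} (at-suc {a'} {n'} d d') eq with ⟨⟩-injective {a'} {suc n'} {a} {suc n} eq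
  ... | refl , refl = _ , d , d'

  deterministic : ∀ {c x y z} → X ⊢ c · x ⇓ y → X ⊢ c · x ⇓ z → y ≡ z
  deterministic zer⇓ zer⇓ = refl
  deterministic succ⇓ succ⇓ = refl
  deterministic left⇓ left⇓ = refl
  deterministic right⇓ right⇓ = refl
  deterministic (yes⇓ _) (yes⇓ _) = refl
  deterministic (yes⇓ p) (no⇓ ¬p) = ⊥-elim (¬p p)
  deterministic (no⇓ ¬p) (yes⇓ p) = ⊥-elim (¬p p)
  deterministic (no⇓ _) (no⇓ _) = refl
  deterministic (pair⇓ d e) (pair⇓ d' e') = cong₂ ⟨_,_⟩ (deterministic d d') (deterministic e e')
  deterministic (comp⇓ d e) (comp⇓ d' e') with deterministic d d'
  ... | refl = deterministic e e'
  deterministic (prec₀⇓ {a = a} d) d' = deterministic d (precView₀ {a = a} (precView d') refl)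
  deterministic (precₛ⇓ {a = a} {n} d e) d' with precViewₛ {a = a} {n} (precView d') refl
  ... | _ , d'' , e' with deterministic d d''
  ... | refl = deterministic e e'
  deterministic (μ⇓ {n = n} d ds) (μ⇓ {n = n'} e es) with <-cmp n n'
  ... | tri≈ _ n≡n' _ = n≡n'
  ... | tri< n<n' _ _ with deterministic d (proj₂ (es n n<n'))
  ...   | ()
  deterministic (μ⇓ {n = n} d ds) (μ⇓ {n = n'} e es)
      | tri> _ _ n'<n with deterministic (proj₂ (ds n' n'<n)) e
  ...   | ()

-- The first index is unpair e, for an index e of the program.
data Shape : ℕ × ℕ → Program → Set where
  zerˢ    : ∀ {r} → Shape (0 , r) zer
  succˢ   : ∀ {r} → Shape (1 , r) succ
  leftˢ   : ∀ {r} → Shape (2 , r) left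
  rightˢ  : ∀ {r} → Shape (3 , r) right
  oracleˢ : ∀ {r} → Shape (4 , r) oracle
  pairˢ   : ∀ {r} → Shape (5 , r) (pair (decode (π₁ r)) (decode (π₂ r)))
  compˢ   : ∀ {r} → Shape (6 , r) (comp (decode (π₁ r)) (decode (π₂ r)))
  precˢ   : ∀ {r} → Shape (7 , r) (prec (decode (π₁ r)) (decode (π₂ r)))
  μˢ      : ∀ {t r} → Shape (8 + t , r) (μ (decode r))

π₁≤ : ∀ n → π₁ n ≤ n
π₁≤ n = subst (π₁ n ≤_) (⟨⟩-unpair n) (fst≤⟨⟩ (π₁ n) (π₂ n))

π₂≤ : ∀ n → π₂ n ≤ n
π₂≤ n = subst (π₂ n ≤_) (⟨⟩-unpair n) (snd≤⟨⟩ (π₁ n) (π₂ n))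

module _ {e t r : ℕ} (eq : unpair e ≡ (suc t , r)) where

  body< : r < e
  body< = subst (r <_)
    (trans (cong₂ ⟨_,_⟩ (sym (cong proj₁ eq)) (sym (cong proj₂ eq))) (⟨⟩-unpair e))
    (snd<⟨suc⟩ t r)

  body≤ : ∀ {n} → e ≤ suc n → r ≤ n
  body≤ e≤1+n = s≤s⁻¹ (≤-trans body< e≤1+n)

-- Subprograms are decoded with the fuel left over from the whole; this identifies them with
-- `decode` of their own indices.
decodeWithin-≥ : ∀ n m e → e ≤ n → e ≤ m → decodeWithin n e ≡ decodeWithin m e
decodeWithin-≥ zero    zero    e e≤n e≤m = refl
decodeWithin-≥ zero    (suc m) .zero z≤n e≤m = refl
decodeWithin-≥ (suc n) zero    .zero e≤n z≤n = refl
decodeWithin-≥ (suc n) (suc m) e e≤n e≤m with unpair e in eq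
... | 0 , r = refl
... | 1 , r = refl
... | 2 , r = refl
... | 3 , r = refl
... | 4 , r = refl
... | 5 , r = cong₂ pair
  (decodeWithin-≥ n m (π₁ r) (≤-trans (π₁≤ r) (body≤ eq e≤n)) (≤-trans (π₁≤ r) (body≤ eq e≤m)))
  (decodeWithin-≥ n m (π₂ r) (≤-trans (π₂≤ r) (body≤ eq e≤n)) (≤-trans (π₂≤ r) (body≤ eq e≤m)))
... | 6 , r = cong₂ comp
  (decodeWithin-≥ n m (π₁ r) (≤-trans (π₁≤ r) (body≤ eq e≤n)) (≤-trans (π₁≤ r) (body≤ eq e≤m)))
  (decodeWithin-≥ n m (π₂ r) (≤-trans (π₂≤ r) (body≤ eq e≤n)) (≤-trans (π₂≤ r) (body≤ eq e≤m)))
... | 7 , r = cong₂ prec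
  (decodeWithin-≥ n m (π₁ r) (≤-trans (π₁≤ r) (body≤ eq e≤n)) (≤-trans (π₁≤ r) (body≤ eq e≤m)))
  (decodeWithin-≥ n m (π₂ r) (≤-trans (π₂≤ r) (body≤ eq e≤n)) (≤-trans (π₂≤ r) (body≤ eq e≤m)))
... | suc (suc (suc (suc (suc (suc (suc (suc t))))))) , r =
  cong μ (decodeWithin-≥ n m r (body≤ eq e≤n) (body≤ eq e≤m))

shape : ∀ e → Shape (unpair e) (decode e)
-- One unit of fuel beyond `e` lets the decoder unfold even at `e = 0`.
shape e = subst (Shape (unpair e)) (decodeWithin-≥ (suc e) e e (n≤1+n e) ≤-refl) within
  where
  fix : ∀ {n} → n ≤ e → decode n ≡ decodeWithin e n
  fix {n} n≤e = decodeWithin-≥ n e n ≤-refl n≤e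
  within : Shape (unpair e) (decodeWithin (suc e) e)
  within with unpair e in eq
  ... | 0 , r = zerˢ
  ... | 1 , r = succˢ
  ... | 2 , r = leftˢ
  ... | 3 , r = rightˢ
  ... | 4 , r = oracleˢ
  ... | 5 , r = subst (Shape _)
    (cong₂ pair (fix (≤-trans (π₁≤ r) (body≤ eq (n≤1+n e)))) (fix (≤-trans (π₂≤ r) (body≤ eq (n≤1+n e))))) pairˢ
  ... | 6 , r = subst (Shape _)
    (cong₂ comp (fix (≤-trans (π₁≤ r) (body≤ eq (n≤1+n e)))) (fix (≤-trans (π₂≤ r) (body≤ eq (n≤1+n e))))) compˢ
  ... | 7 , r = subst (Shape _)
    (cong₂ prec (fix (≤-trans (π₁≤ r) (body≤ eq (n≤1+n e)))) (fix (≤-trans (π₂≤ r) (body≤ eq (n≤1+n e))))) precˢ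
  ... | suc (suc (suc (suc (suc (suc (suc (suc t))))))) , r =
    subst (Shape _) (cong μ (fix (body≤ eq (n≤1+n e)))) μˢ

-- One step of a computation: the fact "program e maps x to y" follows from
-- the facts in M and the answer O of the oracle.  The last index is unpair e.
data Rule (O : Set) (M : ℕ → ℕ → ℕ → Set) (e x y : ℕ) : ℕ × ℕ → Set where
  zerᴿ    : ∀ {r} → y ≡ 0 → Rule O M e x y (0 , r)
  succᴿ   : ∀ {r} → y ≡ suc x → Rule O M e x y (1 , r)
  leftᴿ   : ∀ {r} → y ≡ π₁ x → Rule O M e x y (2 , r)
  rightᴿ  : ∀ {r} → y ≡ π₂ x → Rule O M e x y (3 , r)
  oracleᴿ : ∀ {r} → O → Rule O M e x y (4 , r)
  pairᴿ   : ∀ {r} → M (π₁ r) x (π₁ y) → M (π₂ r) x (π₂ y) → Rule O M e x y (5 , r)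
  compᴿ   : ∀ {r v} → M (π₂ r) x v → M (π₁ r) v y → Rule O M e x y (6 , r)
  prec₀ᴿ  : ∀ {r} → π₂ x ≡ 0 → M (π₁ r) (π₁ x) y → Rule O M e x y (7 , r)
  precₛᴿ  : ∀ {r n v} → suc n ≡ π₂ x → M e ⟪ π₁ x , n ⟫ v →
            M (π₂ r) ⟪ π₁ x , ⟪ n , v ⟫ ⟫ y → Rule O M e x y (7 , r)
  μᴿ      : ∀ {t r} → M r ⟪ x , y ⟫ 0 → (∀ m → m < y → ∃ λ v → M r ⟪ x , m ⟫ (suc v)) →
            Rule O M e x y (8 + t , r)

mapRule : ∀ {O O' M M' e x y q} → (O → O') → (∀ {e x y} → M e x y → M' e x y) →
          Rule O M e x y q → Rule O' M' e x y q
mapRule f g (zerᴿ p)       = zerᴿ p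
mapRule f g (succᴿ p)      = succᴿ p
mapRule f g (leftᴿ p)      = leftᴿ p
mapRule f g (rightᴿ p)     = rightᴿ p
mapRule f g (oracleᴿ o)    = oracleᴿ (f o)
mapRule f g (pairᴿ p q)    = pairᴿ (g p) (g q)
mapRule f g (compᴿ p q)    = compᴿ (g p) (g q)
mapRule f g (prec₀ᴿ p q)   = prec₀ᴿ p (g q)
mapRule f g (precₛᴿ p q r) = precₛᴿ p (g q) (g r)
mapRule f g (μᴿ p q)       = μᴿ (g p) (λ m m<y → proj₁ (q m m<y) , g (proj₂ (q m m<y)))

OracleGraph : Pred ℕ 0ℓ → ℕ → ℕ → Set
OracleGraph Y x y = (Y x × y ≡ 1) ⊎ (¬ Y x × y ≡ 0)

module _ {Y : Pred ℕ 0ℓ} where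

  -- The program is a variable `p` so that `Shape` can be matched. The equation with `decode e`
  -- serves `precₛᴿ`, whose first premise refers back to `e` itself.
  rule-sound : ∀ {e p q x y} → Shape q p → p ≡ decode e →
               Rule (OracleGraph Y x y) (λ e x y → Y ⊢ decode e · x ⇓ y) e x y q →
               Y ⊢ p · x ⇓ y
  rule-sound zerˢ _ (zerᴿ refl) = zer⇓
  rule-sound succˢ _ (succᴿ refl) = succ⇓
  rule-sound {x = x} leftˢ _ (leftᴿ refl) = left⇓ {x = x}
  rule-sound {x = x} rightˢ _ (rightᴿ refl) = right⇓ {x = x}
  rule-sound oracleˢ _ (oracleᴿ (inj₁ (p , refl))) = yes⇓ p
  rule-sound oracleˢ _ (oracleᴿ (inj₂ (¬p , refl))) = no⇓ ¬p
  rule-sound {y = y} pairˢ _ (pairᴿ d d') = cast⇓ (⟪⟫-η y) (pair⟪⟫⇓ d d')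
  rule-sound compˢ _ (compᴿ d d') = comp⇓ d d'
  rule-sound {x = x} precˢ _ (prec₀ᴿ eq d) =
    subst (Y ⊢ _ ·_⇓ _) (trans (cong ⟪ π₁ x ,_⟫ (sym eq)) (⟪⟫-η x)) (prec₀⟪⟫⇓ d)
  rule-sound {x = x} precˢ pe (precₛᴿ eq d d') =
    subst (Y ⊢ _ ·_⇓ _) (trans (cong ⟪ π₁ x ,_⟫ eq) (⟪⟫-η x))
      (precₛ⟪⟫⇓ (subst (Y ⊢_· _ ⇓ _) (sym pe) d) d')
  rule-sound μˢ _ (μᴿ d ds) = μ⟪⟫⇓ d ds

  -- Newest fact first.
  data Derivation : List (ℕ × ℕ × ℕ) → Set where
    []  : Derivation []
    _∷_ : ∀ {ts e x y} → Rule (OracleGraph Y x y) (λ e x y → (e , x , y) ∈ ts) e x y (unpair e) →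
          Derivation ts → Derivation ((e , x , y) ∷ ts)

  _++ᵈ_ : ∀ {ts us} → Derivation ts → Derivation us → Derivation (ts ++ us)
  []      ++ᵈ us = us
  (t ∷ ts) ++ᵈ us = mapRule (λ o → o) ∈-++⁺ˡ t ∷ (ts ++ᵈ us)

  Derives : ℕ → ℕ → ℕ → Set
  Derives e x y = ∃ λ ts → Derivation ts × (e , x , y) ∈ ts

  -- For the premises of `μ`, whose number varies: their derivations are concatenated into one.
  derive-all : ∀ {e y} {x : ℕ → ℕ} {z : ℕ → ℕ → ℕ} →
               (∀ m → m < y → ∃ λ v → Derives e (x m) (z m v)) →
               ∃ λ ts → Derivation ts × (∀ m → m < y → ∃ λ v → (e , x m , z m v) ∈ ts)
  derive-all {y = zero} ds = [] , [] , λ _ ()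
  derive-all {e} {suc y} {x} {z} ds
    with derive-all {e} {y} {x} {z} (λ m m<y → ds m (m<n⇒m<1+n m<y)) | ds y ≤-refl
  ... | ts , D , covers | v , us , D' , us∋ = ts ++ us , (D ++ᵈ D') , cover
    where
    cover : ∀ m → m < suc y → ∃ λ v → (e , x m , z m v) ∈ ts ++ us
    cover m m<1+y with m<1+n⇒m<n∨m≡n m<1+y
    ... | inj₁ m<y  = proj₁ (covers m m<y) , ∈-++⁺ˡ (proj₂ (covers m m<y))
    ... | inj₂ refl = v , ∈-++⁺ʳ ts us∋

  conclude : ∀ {e x y q ts} → unpair e ≡ q → Derivation ts →
             Rule (OracleGraph Y x y) (λ e x y → (e , x , y) ∈ ts) e x y q → Derives e x y
  conclude refl D r = _ , r ∷ D , here refl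

  -- The index `e` is any number of the right shape, so the earlier stage of a `prec` computation
  -- can be recorded under the same index as the whole.
  derives : ∀ {p e q x y} → Y ⊢ p · x ⇓ y → unpair e ≡ q → Shape q p → Derives e x y

  derives-decode : ∀ {e x y} → Y ⊢ decode e · x ⇓ y → Derives e x y
  derives-decode {e} d = derives d refl (shape e)

  derives zer⇓ eq zerˢ = conclude eq [] (zerᴿ refl)
  derives succ⇓ eq succˢ = conclude eq [] (succᴿ refl)
  derives left⇓ eq leftˢ = conclude eq [] (leftᴿ refl)
  derives right⇓ eq rightˢ = conclude eq [] (rightᴿ refl)
  derives (yes⇓ p) eq oracleˢ = conclude eq [] (oracleᴿ (inj₁ (p , refl)))
  derives (no⇓ ¬p) eq oracleˢ = conclude eq [] (oracleᴿ (inj₂ (¬p , refl)))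
  derives {x = x} (pair⇓ {y = y} {z} d d') eq pairˢ
    with derives-decode d | derives-decode d'
  ... | ts , D , ts∋ | us , D' , us∋ = conclude eq (D ++ᵈ D') (pairᴿ
    (subst (λ y → (_ , _ , y) ∈ _) (sym (cong proj₁ (unpair-⟨⟩ y z))) (∈-++⁺ˡ ts∋))
    (subst (λ y → (_ , _ , y) ∈ _) (sym (cong proj₂ (unpair-⟨⟩ y z))) (∈-++⁺ʳ ts us∋)))
  derives (comp⇓ d d') eq compˢ with derives-decode d | derives-decode d'
  ... | ts , D , ts∋ | us , D' , us∋ =
    conclude eq (D ++ᵈ D') (compᴿ (∈-++⁺ˡ ts∋) (∈-++⁺ʳ ts us∋))
  derives (prec₀⇓ {a = a} d) eq precˢ with derives-decode d
  ... | ts , D , ts∋ = conclude eq D (prec₀ᴿ (cong proj₂ (unpair-⟨⟩ a 0))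
    (subst (λ x → (_ , x , _) ∈ _) (sym (cong proj₁ (unpair-⟨⟩ a 0))) ts∋))
  derives (precₛ⇓ {a = a} {n} {y} d d') eq precˢ
    with derives d eq precˢ | derives-decode d'
  ... | ts , D , ts∋ | us , D' , us∋ =
    conclude eq (D ++ᵈ D') (precₛᴿ {n = n} {y} (sym (cong proj₂ u))
      (∈-++⁺ˡ (subst (λ x → (_ , x , _) ∈ ts) fix ts∋))
      (∈-++⁺ʳ ts (subst (λ x → (_ , x , _) ∈ us) fix' us∋)))
    where
    u = unpair-⟨⟩ a (suc n)
    fix : ⟨ a , n ⟩ ≡ ⟪ π₁ ⟨ a , suc n ⟩ , n ⟫
    fix = trans (sym ⟪⟫≡⟨⟩) (cong ⟪_, n ⟫ (sym (cong proj₁ u)))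
    fix' : ⟨ a , ⟨ n , y ⟩ ⟩ ≡ ⟪ π₁ ⟨ a , suc n ⟩ , ⟪ n , y ⟫ ⟫
    fix' = trans (sym ⟪⟫≡⟨⟩) (cong₂ ⟪_,_⟫ (sym (cong proj₁ u)) (sym ⟪⟫≡⟨⟩))
  derives {e = e} (μ⇓ {f} {a} {n} d ds) eq (μˢ {r = r})
    with derives-decode d
       | derive-all {r} {n} {λ m → ⟨ a , m ⟩} {λ _ v → suc v}
           (λ m m<n → proj₁ (ds m m<n) , derives-decode (proj₂ (ds m m<n)))
  ... | ts , D , ts∋ | us , D' , us∋ =
    conclude eq (D ++ᵈ D') (μᴿ (∈-++⁺ˡ (subst (λ x → (_ , x , _) ∈ ts) (sym ⟪⟫≡⟨⟩) ts∋))
      (λ m m<n → proj₁ (us∋ m m<n) ,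
        ∈-++⁺ʳ ts (subst (λ x → (_ , x , _) ∈ us) (sym ⟪⟫≡⟨⟩) (proj₂ (us∋ m m<n)))))

-- Computations coded as numbers

drop-suc : ∀ j w → drop (suc j) w ≡ drop j (π₂ w)
drop-suc zero    w = refl
drop-suc (suc j) w = cong π₂ (drop-suc j w)

nth-here : ∀ {x w} → nth ⟪ x , w ⟫ 0 ≡ x
nth-here = π₁-⟪⟫

nth-there : ∀ {x w} j → nth ⟪ x , w ⟫ (suc j) ≡ nth w j
nth-there {x} {w} j =
  cong π₁ (trans (drop-suc j ⟪ x , w ⟫) (cong (drop j) π₂-⟪⟫))

tabulated : (F : ℕ → ℕ) (n : ℕ) → ∃ λ w → ∀ i → i < n → nth w i ≡ F i
tabulated F zero = 0 , λ _ ()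
tabulated F (suc n) with tabulated (λ i → F (suc i)) n
... | w , eq = ⟪ F 0 , w ⟫ , λ where
  zero    _         → nth-here
  (suc i) (s≤s i<n) → trans (nth-there i) (eq i i<n)

drop≤ : ∀ j w → drop j w ≤ w
drop≤ zero    w = ≤-refl
drop≤ (suc j) w = ≤-trans (π₂≤ (drop j w)) (drop≤ j w)

nth≤ : ∀ w j → nth w j ≤ w
nth≤ w j = ≤-trans (π₁≤ (drop j w)) (drop≤ j w)

snd≤⟪⟫ : ∀ {a b} → b ≤ ⟪ a , b ⟫
snd≤⟪⟫ {a} {b} = subst (b ≤_) (sym ⟪⟫≡⟨⟩) (snd≤⟨⟩ a b)

-- Newest fact first: the facts available at position i come after it.
Member : ℕ → ℕ → ℕ → ℕ → ℕ → ℕ → Set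
Member i L w e x y = ∃ λ j → j < L × i < j × nth w j ≡ ⟪ e , ⟪ x , y ⟫ ⟫

-- This makes checking a bounded matter: a recorded output is at most the code `w` of the list, so
-- the intermediate values of `comp`, `prec` and `μ` can be sought below `suc w`.
member-bound : ∀ {i L w e x y} → Member i L w e x y → y < suc w
member-bound {w = w} (j , _ , _ , eq) =
  s≤s (≤-trans snd≤⟪⟫ (≤-trans snd≤⟪⟫ (subst (_≤ w) eq (nth≤ w j))))

-- The oracle condition is a parameter depending on the position, because for the jump it becomes a
-- condition on a witness stored at that position.
Certificate : (ℕ → Set) → ℕ → ℕ → Set
Certificate O L w = ∀ i → i < L → ∀ {e x y} → nth w i ≡ ⟪ e , ⟪ x , y ⟫ ⟫ →
  Rule (O i) (Member i L w) e x y (unpair e)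

module _ {Y : Pred ℕ 0ℓ} where

  certificate-sound : ∀ {O L w} →
    (∀ {i e x y} → nth w i ≡ ⟪ e , ⟪ x , y ⟫ ⟫ → O i → OracleGraph Y x y) →
    Certificate O L w →
    ∀ i → i < L → ∀ {e x y} → nth w i ≡ ⟪ e , ⟪ x , y ⟫ ⟫ → Y ⊢ decode e · x ⇓ y
  certificate-sound {O} {L} {w} answers cert i i<L = after (L ∸ i) i i<L ≤-refl
    where
    -- A fact depends only on later positions, so the induction is on the distance `L ∸ i` to the
    -- end.
    after : ∀ d i → i < L → L ∸ i ≤ d → ∀ {e x y} → nth w i ≡ ⟪ e , ⟪ x , y ⟫ ⟫ →
            Y ⊢ decode e · x ⇓ y
    after zero i i<L le = ⊥-elim (<⇒≱ (m<n⇒0<n∸m i<L) le)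
    after (suc d) i i<L le {e} eq = rule-sound (shape e) refl (mapRule (answers eq)
      (λ (j , j<L , i<j , eq') →
        after d j j<L (s≤s⁻¹ (≤-trans (∸-monoʳ-< i<j (<⇒≤ j<L)) le)) eq')
      (cert i i<L eq))

  codeFacts : List (ℕ × ℕ × ℕ) → ℕ
  codeFacts [] = 0
  codeFacts ((e , x , y) ∷ ts) = ⟪ ⟪ e , ⟪ x , y ⟫ ⟫ , codeFacts ts ⟫

  ∈⇒nth : ∀ {ts e x y} → (e , x , y) ∈ ts →
          ∃ λ j → j < length ts × nth (codeFacts ts) j ≡ ⟪ e , ⟪ x , y ⟫ ⟫
  ∈⇒nth (here refl) = 0 , z<s , nth-here
  ∈⇒nth (there p) with ∈⇒nth p
  ... | j , j<n , eq = suc j , s≤s j<n , trans (nth-there j) eq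

  Answer : ℕ → ℕ → Set
  Answer w i = OracleGraph Y (π₁ (π₂ (nth w i))) (π₂ (π₂ (nth w i)))

  fact-input : ∀ {f e x y} → f ≡ ⟪ e , ⟪ x , y ⟫ ⟫ → π₁ (π₂ f) ≡ x
  fact-input refl = trans (cong π₁ π₂-⟪⟫) π₁-⟪⟫

  fact-output : ∀ {f e x y} → f ≡ ⟪ e , ⟪ x , y ⟫ ⟫ → π₂ (π₂ f) ≡ y
  fact-output refl = trans (cong π₂ π₂-⟪⟫) π₂-⟪⟫

  derivation⇒certificate : ∀ {ts} → Derivation {Y} ts →
                           Certificate (Answer (codeFacts ts)) (length ts) (codeFacts ts)
  derivation⇒certificate [] i ()
  derivation⇒certificate {(e' , x' , y') ∷ ts} (t ∷ D) zero _ eq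
    with ⟪⟫-injective (trans (sym nth-here) eq)
  ... | refl , eq' with ⟪⟫-injective eq'
  ... | refl , refl = mapRule
    (λ o → subst₂ (OracleGraph Y) (sym (fact-input eq)) (sym (fact-output eq)) o)
    (λ p → let (j , j<n , eq) = ∈⇒nth p in suc j , s≤s j<n , z<s , trans (nth-there j) eq)
    t
  derivation⇒certificate {_ ∷ ts} (t ∷ D) (suc i) (s≤s i<n) eq = mapRule
    (λ o → subst (λ f → OracleGraph Y (π₁ (π₂ f)) (π₂ (π₂ f))) (sym (nth-there i)) o)
    (λ (j , j<n , i<j , eq) → suc j , s≤s j<n , s≤s i<j , trans (nth-there j) eq)
    (derivation⇒certificate D i i<n (trans (sym (nth-there i)) eq))

  certificate-complete : ∀ {e x y} → Y ⊢ decode e · x ⇓ y → ∃₂ λ L w →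
    Certificate (Answer w) L w × ∃ λ i → i < L × nth w i ≡ ⟪ e , ⟪ x , y ⟫ ⟫
  certificate-complete d with derives-decode d
  ... | ts , D , ts∋ = length ts , codeFacts ts , derivation⇒certificate D , ∈⇒nth ts∋

-- Variables: e, x, y, i, L, w.
memberᶠ : Formula 6
memberᶠ = ex< (var (# 4))
  (var (# 4) ≺̇ var (# 0) ∧̇
   entry (var (# 6)) (var (# 0)) ≐ pr (var (# 1)) (pr (var (# 2)) (var (# 3))))

module _ {n : ℕ} (i L w : Term n) where

  memberAt : Term n → Term n → Term n → Formula n
  memberAt e x y = substitute memberᶠ (e ∷ x ∷ y ∷ i ∷ L ∷ w ∷ [])

-- Variables as in memberᶠ.
opaque
  ruleᶠ : Formula 6
  ruleᶠ =
      fst e ≐ lit 0 ∧̇ y ≐ lit 0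
    ∨̇ fst e ≐ lit 1 ∧̇ y ≐ sucᵗ x
    ∨̇ fst e ≐ lit 2 ∧̇ y ≐ fst x
    ∨̇ fst e ≐ lit 3 ∧̇ y ≐ snd x
    ∨̇ fst e ≐ lit 5 ∧̇ known (fst (snd e)) x (fst y) ∧̇ known (snd (snd e)) x (snd y)
    ∨̇ fst e ≐ lit 6 ∧̇ ex< (sucᵗ w)
        (known₁ (snd (snd e₁)) x₁ (var (# 0)) ∧̇ known₁ (fst (snd e₁)) (var (# 0)) y₁)
    ∨̇ fst e ≐ lit 7 ∧̇ snd x ≐ lit 0 ∧̇ known (fst (snd e)) (fst x) y
    ∨̇ fst e ≐ lit 7 ∧̇ ex< (snd x) (sucᵗ (var (# 0)) ≐ snd x₁ ∧̇ ex< (sucᵗ w₁)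
        (known₂ e₂ (pr (fst x₂) (var (# 1))) (var (# 0)) ∧̇
         known₂ (snd (snd e₂)) (pr (fst x₂) (pr (var (# 1)) (var (# 0)))) y₂))
    ∨̇ lit 7 ≺̇ fst e ∧̇ known (snd e) (pr x y) (lit 0) ∧̇ all< y (ex< (sucᵗ w₁)
        (known₂ (snd e₂) (pr x₂ (var (# 1))) (sucᵗ (var (# 0)))))
    where
    e x y w : Term 6
    e = var (# 0)
    x = var (# 1)
    y = var (# 2)
    w = var (# 5)
    e₁ x₁ y₁ w₁ : Term 7
    e₁ = var (# 1)
    x₁ = var (# 2)
    y₁ = var (# 3)
    w₁ = var (# 6)
    e₂ x₂ y₂ : Term 8
    e₂ = var (# 2)
    x₂ = var (# 3)
    y₂ = var (# 4)
    known : Term 6 → Term 6 → Term 6 → Formula 6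
    known = memberAt {6} (var (# 3)) (var (# 4)) (var (# 5))
    known₁ : Term 7 → Term 7 → Term 7 → Formula 7
    known₁ = memberAt {7} (var (# 4)) (var (# 5)) (var (# 6))
    known₂ : Term 8 → Term 8 → Term 8 → Formula 8
    known₂ = memberAt {8} (var (# 5)) (var (# 6)) (var (# 7))

module _ {P : Pred ℕ 0ℓ} where

  at-tag : ∀ {O M e x y t} → π₁ e ≡ t → Rule O M e x y (t , π₂ e) → Rule O M e x y (unpair e)
  at-tag {e = e} eq = subst (λ t → Rule _ _ _ _ _ (t , π₂ e)) (sym eq)

  opaque
    unfolding ruleᶠ

    -- Oracle queries are absent from `ruleᶠ`, hence `Rule ⊥`; they form the second disjunct of
    -- `justified`.
    holds⇒rule : ∀ {e x y i L w} → Holds P (e ∷ x ∷ y ∷ i ∷ L ∷ w ∷ []) ruleᶠ →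
                 Rule ⊥ (Member i L w) e x y (unpair e)
    holds⇒rule (inj₁ (t , p)) = at-tag t (zerᴿ p)
    holds⇒rule (inj₂ (inj₁ (t , p))) = at-tag t (succᴿ p)
    holds⇒rule (inj₂ (inj₂ (inj₁ (t , p)))) = at-tag t (leftᴿ p)
    holds⇒rule (inj₂ (inj₂ (inj₂ (inj₁ (t , p))))) = at-tag t (rightᴿ p)
    holds⇒rule (inj₂ (inj₂ (inj₂ (inj₂ (inj₁ (t , p , q)))))) = at-tag t (pairᴿ p q)
    holds⇒rule (inj₂ (inj₂ (inj₂ (inj₂ (inj₂ (inj₁ (t , v , _ , p , q))))))) =
      at-tag t (compᴿ p q)
    holds⇒rule (inj₂ (inj₂ (inj₂ (inj₂ (inj₂ (inj₂ (inj₁ (t , p , q)))))))) =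
      at-tag t (prec₀ᴿ p q)
    holds⇒rule (inj₂ (inj₂ (inj₂ (inj₂ (inj₂ (inj₂ (inj₂ (inj₁ (t , n , _ , p , v , _ , q , r))))))))) =
      at-tag t (precₛᴿ p q r)
    holds⇒rule (inj₂ (inj₂ (inj₂ (inj₂ (inj₂ (inj₂ (inj₂ (inj₂ (7<t , p , q))))))))) =
      let (_ , eq) = m≤n⇒∃[o]m+o≡n 7<t in
      at-tag (sym eq) (μᴿ p (λ m m<y → let (v , _ , r) = q m m<y in v , r))

    rule⇒holds : ∀ {e x y i L w q} → Rule ⊥ (Member i L w) e x y q → q ≡ unpair e →
                 Holds P (e ∷ x ∷ y ∷ i ∷ L ∷ w ∷ []) ruleᶠ
    rule⇒holds (zerᴿ p) eq = inj₁ (sym (cong proj₁ eq) , p)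
    rule⇒holds (succᴿ p) eq = inj₂ (inj₁ (sym (cong proj₁ eq) , p))
    rule⇒holds (leftᴿ p) eq = inj₂ (inj₂ (inj₁ (sym (cong proj₁ eq) , p)))
    rule⇒holds (rightᴿ p) eq = inj₂ (inj₂ (inj₂ (inj₁ (sym (cong proj₁ eq) , p))))
    rule⇒holds {x = x} {y} (pairᴿ p q) eq = inj₂ (inj₂ (inj₂ (inj₂ (inj₁
      (sym (cong proj₁ eq) ,
       subst (λ r → Member _ _ _ (π₁ r) x (π₁ y)) (cong proj₂ eq) p ,
       subst (λ r → Member _ _ _ (π₂ r) x (π₂ y)) (cong proj₂ eq) q)))))
    rule⇒holds {x = x} {y} (compᴿ {v = v} p q) eq = inj₂ (inj₂ (inj₂ (inj₂ (inj₂ (inj₁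
      (sym (cong proj₁ eq) , v , member-bound p ,
       subst (λ r → Member _ _ _ (π₂ r) x v) (cong proj₂ eq) p ,
       subst (λ r → Member _ _ _ (π₁ r) v y) (cong proj₂ eq) q))))))
    rule⇒holds {x = x} {y} (prec₀ᴿ p q) eq = inj₂ (inj₂ (inj₂ (inj₂ (inj₂ (inj₂ (inj₁
      (sym (cong proj₁ eq) , p ,
       subst (λ r → Member _ _ _ (π₁ r) (π₁ x) y) (cong proj₂ eq) q)))))))
    rule⇒holds {x = x} {y} (precₛᴿ {n = n} {v} p q r) eq =
      inj₂ (inj₂ (inj₂ (inj₂ (inj₂ (inj₂ (inj₂ (inj₁
      (sym (cong proj₁ eq) , n , subst (n <_) p ≤-refl , p , v , member-bound q , q ,
       subst (λ r → Member _ _ _ (π₂ r) ⟪ π₁ x , ⟪ n , v ⟫ ⟫ y) (cong proj₂ eq) r))))))))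
    rule⇒holds {x = x} {y} (μᴿ {t} p q) eq =
      inj₂ (inj₂ (inj₂ (inj₂ (inj₂ (inj₂ (inj₂ (inj₂
      (subst (7 <_) (cong proj₁ eq) (m≤m+n 8 t) ,
       subst (λ r → Member _ _ _ r ⟪ x , y ⟫ 0) (cong proj₂ eq) p ,
       λ m m<y → let (v , r) = q m m<y in v , <-trans ≤-refl (member-bound r) ,
         subst (λ r → Member _ _ _ r ⟪ x , m ⟫ (suc v)) (cong proj₂ eq) r))))))))

module _ {n : ℕ} where

  -- Variable 0 is a position in the list w of L facts; o expresses that the
  -- oracle gives the answer recorded there.
  opaque
    justified : (L w : Term (suc n)) → Formula (suc n) → Formula (suc n)
    justified L w o =
      substitute ruleᶠ (fst fact ∷ fst (snd fact) ∷ snd (snd fact) ∷ var zero ∷ L ∷ w ∷ [])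
      ∨̇ fst (fst fact) ≐ lit 4 ∧̇ o
      where
      fact : Term (suc n)
      fact = entry w (var zero)

module _ {P : Pred ℕ 0ℓ} {n : ℕ} {L w : Term (suc n)} {o : Formula (suc n)} (i : ℕ) (ρ : Vec ℕ n) where

  private
    ⟦L⟧ = eval (i ∷ ρ) L
    ⟦w⟧ = eval (i ∷ ρ) w

  opaque
    unfolding justified

    justified⇒rule : Holds P (i ∷ ρ) (justified L w o) → ∀ {e x y} → nth ⟦w⟧ i ≡ ⟪ e , ⟪ x , y ⟫ ⟫ →
                     Rule (Holds P (i ∷ ρ) o) (Member i ⟦L⟧ ⟦w⟧) e x y (unpair e)
    justified⇒rule h {e} eq with trans (cong π₁ eq) π₁-⟪⟫ | fact-input {P} eq | fact-output {P} eq
    justified⇒rule (inj₁ h)       eq | refl | refl | refl =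
      mapRule ⊥-elim (λ m → m) (holds⇒rule {P} h)
    justified⇒rule (inj₂ (t , h)) eq | refl | refl | refl = at-tag {P} t (oracleᴿ h)

    rule⇒justified : (∀ {e x y} → nth ⟦w⟧ i ≡ ⟪ e , ⟪ x , y ⟫ ⟫ →
                     Rule (Holds P (i ∷ ρ) o) (Member i ⟦L⟧ ⟦w⟧) e x y (unpair e)) →
                     Holds P (i ∷ ρ) (justified L w o)
    rule⇒justified r = go refl (r (sym (trans (cong ⟪ π₁ f ,_⟫ (⟪⟫-η (π₂ f))) (⟪⟫-η f))))
      where
      f : ℕ
      f = nth ⟦w⟧ i
      go : ∀ {q} → q ≡ unpair (π₁ f) →
           Rule (Holds P (i ∷ ρ) o) (Member i ⟦L⟧ ⟦w⟧) (π₁ f) (π₁ (π₂ f)) (π₂ (π₂ f)) q →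
           Holds P (i ∷ ρ) (justified L w o)
      go eq (oracleᴿ h) = inj₂ (sym (cong proj₁ eq) , h)
      go eq (zerᴿ p) = inj₁ (rule⇒holds {P} (zerᴿ p) eq)
      go eq (succᴿ p) = inj₁ (rule⇒holds {P} (succᴿ p) eq)
      go eq (leftᴿ p) = inj₁ (rule⇒holds {P} (leftᴿ p) eq)
      go eq (rightᴿ p) = inj₁ (rule⇒holds {P} (rightᴿ p) eq)
      go eq (pairᴿ p q) = inj₁ (rule⇒holds {P} (pairᴿ p q) eq)
      go eq (compᴿ p q) = inj₁ (rule⇒holds {P} (compᴿ p q) eq)
      go eq (prec₀ᴿ p q) = inj₁ (rule⇒holds {P} (prec₀ᴿ p q) eq)
      go eq (precₛᴿ p q r) = inj₁ (rule⇒holds {P} (precₛᴿ p q r) eq)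
      go eq (μᴿ p q) = inj₁ (rule⇒holds {P} (μᴿ p q) eq)

-- The jump and its Σ₂ graph

-- Variables: e and a certificate ⟪ L , w ⟫ that program e halts on input e.
opaque
  haltᶠ : Formula 2
  haltᶠ = all< (fst (var (# 1))) (justified L w answer) ∧̇
          ex< (fst (var (# 1))) (fst fact ≐ var (# 1) ∧̇ fst (snd fact) ≐ var (# 1))
    where
    L w fact : Term 3
    L = fst (var (# 2))
    w = snd (var (# 2))
    fact = entry w (var (# 0))
    answer : Formula 3
    answer = rel (fst (snd fact)) ∧̇ snd (snd fact) ≐ lit 1
           ∨̇ ¬̇ rel (fst (snd fact)) ∧̇ snd (snd fact) ≐ lit 0

  -- Kleene's normal form: the only unbounded quantifier is the one over the certificate.
  haltᶠ-correct : ∀ {X e} → (X ′) e ⇔ ∃ λ h → Holds X (e ∷ h ∷ []) haltᶠ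
  haltᶠ-correct {X} {e} = mk⇔ complete sound
    where
    complete : (X ′) e → ∃ λ h → Holds X (e ∷ h ∷ []) haltᶠ
    complete (y , d) with certificate-complete d
    ... | L , w , cert , i , i<L , eq = ⟪ L , w ⟫ , holds {⟪ L , w ⟫} L w π₁-⟪⟫ π₂-⟪⟫ cert i i<L eq
      where
      -- Projections of a pair compute only up to a proved equation, so `h` is a variable with given
      -- projections and the equations are matched with `refl`.
      holds : ∀ {h} L w → π₁ h ≡ L → π₂ h ≡ w → Certificate (Answer {X} w) L w → ∀ i → i < L →
              nth w i ≡ ⟪ e , ⟪ e , y ⟫ ⟫ → Holds X (e ∷ h ∷ []) haltᶠ
      holds {h} .(π₁ h) .(π₂ h) refl refl cert i i<L eq =
        (λ i i<L → rule⇒justified i (e ∷ h ∷ []) (cert i i<L)) ,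
        i , i<L , trans (cong π₁ eq) π₁-⟪⟫ , fact-input {X} eq
    sound : (∃ λ h → Holds X (e ∷ h ∷ []) haltᶠ) → (X ′) e
    sound (h , just , i , i<L , eq , eq') = y , certificate-sound
      (λ eq o → subst₂ (OracleGraph X) (fact-input {X} eq) (fact-output {X} eq) o)
      (λ i i<L → justified⇒rule i (e ∷ h ∷ []) (just i i<L)) i i<L fact≡
      where
      f y : ℕ
      f = nth (π₂ h) i
      y = π₂ (π₂ f)
      fact≡ : f ≡ ⟪ e , ⟪ e , y ⟫ ⟫
      fact≡ = trans (sym (⟪⟫-η f)) (cong₂ ⟪_,_⟫ eq
        (trans (sym (⟪⟫-η (π₂ f))) (cong ⟪_, y ⟫ eq')))

module _ (k : ℕ) where

  -- Variables: x, y, a certificate ⟪ L , ⟪ w , V ⟫ ⟫ that program k with the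
  -- jump as oracle maps x to y, and a bound t for refuting it.  The list V
  -- has the halting certificates for the positive answers.
  opaque
    reachᶠ : Formula 4
    reachᶠ = all< (fst (var (# 2))) (justified L w answer) ∧̇
             ex< (fst (var (# 2))) (fact ≐ pr (lit k) (pr (var (# 1)) (var (# 2))))
      where
      L w V fact : Term 5
      L = fst (var (# 3))
      w = fst (snd (var (# 3)))
      V = snd (snd (var (# 3)))
      fact = entry w (var (# 0))
      answer : Formula 5
      answer =
        substitute haltᶠ (fst (snd fact) ∷ entry V (var (# 0)) ∷ []) ∧̇ snd (snd fact) ≐ lit 1
        ∨̇ ¬̇ substitute haltᶠ (fst (snd fact) ∷ var (# 4) ∷ []) ∧̇ snd (snd fact) ≐ lit 0

module Jump (em : ExcludedMiddle 0ℓ) (X : Pred ℕ 0ℓ) where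

  open Classical em

  Halts : ℕ → ℕ → Set
  Halts x h = Holds X (x ∷ h ∷ []) haltᶠ

  -- The answer y to the query x, justified by the certificate v if it is
  -- positive and not refuted by t if it is negative.
  JumpAnswer : ℕ → ℕ → ℕ → ℕ → Set
  JumpAnswer x y v t = (Halts x v × y ≡ 1) ⊎ (¬ Halts x t × y ≡ 0)

  answer-witness : ∀ {x y} → OracleGraph (X ′) x y → ∃ λ v → ∀ t → JumpAnswer x y v t
  answer-witness (inj₁ (p , eq)) = let (v , h) = to haltᶠ-correct p in v , λ _ → inj₁ (h , eq)
  answer-witness (inj₂ (¬p , eq)) =
    0 , λ t → inj₂ ((λ h → ¬p (from haltᶠ-correct (t , h))) , eq)

  -- The side is the same for all `t`: a positive answer does not mention `t`, and a negative one
  -- fixes `y` as 0, which excludes the positive side everywhere.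
  witness-answer : ∀ {x y v} → (∀ t → JumpAnswer x y v t) → OracleGraph (X ′) x y
  witness-answer {x} {v = v} ans with ans 0
  ... | inj₁ (h , eq) = inj₁ (from haltᶠ-correct (v , h) , eq)
  ... | inj₂ (_ , refl) = inj₂ ((λ p → let (t , h) = to haltᶠ-correct p in refute t h) , refl)
    where
    refute : ∀ t → ¬ Halts x t
    refute t h with ans t
    ... | inj₂ (¬h , _) = ¬h h

  choose : (w : ℕ) → ℕ → ℕ
  choose w i with em {Answer {X ′} w i}
  ... | yes o = proj₁ (answer-witness o)
  -- A default for the positions that do not record a true answer of the jump.
  ... | no _  = 0

  choose-correct : ∀ w i → Answer {X ′} w i →
    ∀ t → JumpAnswer (π₁ (π₂ (nth w i))) (π₂ (π₂ (nth w i))) (choose w i) t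
  choose-correct w i o with em {Answer {X ′} w i}
  ... | yes o = proj₂ (answer-witness o)
  ... | no ¬o = ⊥-elim (¬o o)

  -- Different `t` might use different rules. But if some `O t` fails, the rule at that `t` is not
  -- the oracle rule, and it then serves for any oracle condition.
  uniform : ∀ {O : ℕ → Set} {M e x y q} → (∀ t → Rule (O t) M e x y q) → Rule (∀ t → O t) M e x y q
  uniform {O} rule with em {∀ t → O t}
  ... | yes o = mapRule (λ _ → o) (λ m → m) (rule 0)
  ... | no ¬o = let (t , ¬ot) = counterexample ¬o in mapRule (λ o → ⊥-elim (¬ot o)) (λ m → m) (rule t)

  opaque
    unfolding reachᶠ

    -- All negative answers are tested against the same `t`, since the quantifier over `t` commutes
    -- with the bounded one over positions; this leaves just one alternation of quantifiers.
    reachᶠ-correct : ∀ {k x y} → X ′ ⊢ decode k · x ⇓ y ⇔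
                     ∃ λ W → ∀ t → Holds X (x ∷ y ∷ W ∷ t ∷ []) (reachᶠ k)
    reachᶠ-correct {k} {x} {y} = mk⇔ complete sound
      where
      complete : X ′ ⊢ decode k · x ⇓ y → ∃ λ W → ∀ t → Holds X (x ∷ y ∷ W ∷ t ∷ []) (reachᶠ k)
      complete d with certificate-complete d
      ... | L , w , cert , i , i<L , eq with tabulated (choose w) L
      ... | V , V≡ = ⟪ L , ⟪ w , V ⟫ ⟫ ,
          holds {⟪ L , ⟪ w , V ⟫ ⟫} π₁-⟪⟫ (trans (cong π₁ π₂-⟪⟫) π₁-⟪⟫) (trans (cong π₂ π₂-⟪⟫) π₂-⟪⟫)
            cert V≡ i i<L eq
        where
        holds : ∀ {W L w V} → π₁ W ≡ L → π₁ (π₂ W) ≡ w → π₂ (π₂ W) ≡ V →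
                Certificate (Answer {X ′} w) L w → (∀ i → i < L → nth V i ≡ choose w i) →
                ∀ i → i < L → nth w i ≡ ⟪ k , ⟪ x , y ⟫ ⟫ →
                ∀ t → Holds X (x ∷ y ∷ W ∷ t ∷ []) (reachᶠ k)
        holds {W} {w = w} refl refl refl cert V≡ i i<L eq t =
          (λ i i<L → rule⇒justified i (x ∷ y ∷ W ∷ t ∷ []) (λ eq → mapRule
            (λ o → subst (λ v → JumpAnswer _ _ v t) (sym (V≡ i i<L)) (choose-correct w i o t))
            (λ m → m) (cert i i<L eq))) ,
          i , i<L , eq
      sound : (∃ λ W → ∀ t → Holds X (x ∷ y ∷ W ∷ t ∷ []) (reachᶠ k)) → X ′ ⊢ decode k · x ⇓ y
      sound (W , h) = let (i , i<L , eq) = proj₂ (h 0) in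
        certificate-sound
          {O = λ i → ∀ t → JumpAnswer (π₁ (π₂ (nth (π₁ (π₂ W)) i)))
                             (π₂ (π₂ (nth (π₁ (π₂ W)) i))) (nth (π₂ (π₂ W)) i) t}
          (λ eq o → subst₂ (OracleGraph (X ′)) (fact-input {X} eq) (fact-output {X} eq) (witness-answer o))
          (λ i i<L eq → uniform (λ t → justified⇒rule i (x ∷ y ∷ W ∷ t ∷ []) (proj₁ (h t) i i<L) eq))
          i i<L eq

-- A ⊕ ∁ A, with every ⟪ n , suc b ⟫ standing for n in the complement.
Join : Pred ℕ 0ℓ → Pred ℕ 0ℓ
Join A k = (π₂ k ≡ 0 × A (π₁ k)) ⊎ (π₂ k ≢ 0 × ¬ A (π₁ k))

module _ (em : ExcludedMiddle 0ℓ) {A X : Pred ℕ 0ℓ} (A≤X′ : A ≤T X ′) where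

  open Classical em
  open Jump em X

  private
    c = proj₁ A≤X′
    k = encode c

    reaches : ∀ {x y} → X ′ ⊢ c · x ⇓ y ⇔ ∃ λ W → ∀ t → Holds X (x ∷ y ∷ W ∷ t ∷ []) (reachᶠ k)
    reaches {x} {y} = subst
      (λ p → X ′ ⊢ p · x ⇓ y ⇔ ∃ λ W → ∀ t → Holds X (x ∷ y ∷ W ∷ t ∷ []) (reachᶠ k))
      (decode-encode c) reachᶠ-correct

  accepted : ∀ {x} → X ′ ⊢ c · x ⇓ 1 → A x
  accepted {x} d = stable λ ¬a → 1+n≢0 (deterministic d (proj₂ (proj₂ A≤X′ x) ¬a))

  rejected : ∀ {x} → X ′ ⊢ c · x ⇓ 0 → ¬ A x
  rejected {x} d a = 1+n≢0 (deterministic (proj₁ (proj₂ A≤X′ x) a) d)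

  -- Membership and non-membership in `A` are both positive facts about a computation, output 1 and
  -- output 0, so both have the form that `reachᶠ` expresses.
  joinᶠ : Formula 3
  joinᶠ = snd (var (# 0)) ≐ lit 0 ∧̇ substitute (reachᶠ k) (fst (var (# 0)) ∷ lit 1 ∷ var (# 1) ∷ var (# 2) ∷ [])
    ∨̇ ¬̇ snd (var (# 0)) ≐ lit 0 ∧̇ substitute (reachᶠ k) (fst (var (# 0)) ∷ lit 0 ∷ var (# 1) ∷ var (# 2) ∷ [])

  joinᶠ-correct : ∀ n → Join A n ⇔ ∃ λ W → ∀ t → Holds X (n ∷ W ∷ t ∷ []) joinᶠ
  joinᶠ-correct n = mk⇔ complete sound
    where
    complete : Join A n → ∃ λ W → ∀ t → Holds X (n ∷ W ∷ t ∷ []) joinᶠ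
    complete (inj₁ (z , a)) =
      let (W , h) = to reaches (proj₁ (proj₂ A≤X′ (π₁ n)) a) in W , λ t → inj₁ (z , h t)
    complete (inj₂ (nz , ¬a)) =
      let (W , h) = to reaches (proj₂ (proj₂ A≤X′ (π₁ n)) ¬a) in W , λ t → inj₂ (nz , h t)
    sound : (∃ λ W → ∀ t → Holds X (n ∷ W ∷ t ∷ []) joinᶠ) → Join A n
    sound (W , h) with π₂ n ≟ 0
    ... | yes z = inj₁ (z , accepted (from reaches (W , λ t → positive (h t))))
      where
      positive : ∀ {P Q : Set} → (π₂ n ≡ 0 × P) ⊎ (π₂ n ≢ 0 × Q) → P
      positive (inj₁ (_ , p)) = p
      positive (inj₂ (nz , _)) = ⊥-elim (nz z)
    ... | no nz = inj₂ (nz , rejected (from reaches (W , λ t → negative (h t))))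
      where
      negative : ∀ {P Q : Set} → (π₂ n ≡ 0 × P) ⊎ (π₂ n ≢ 0 × Q) → Q
      negative (inj₁ (z , _)) = ⊥-elim (nz z)
      negative (inj₂ (_ , q)) = q

-- Forests

infix 4 _<ᵠ_ _≤ᵠ_

-- Read as `a / suc c ≤ b / suc d < e / suc f`; the middle denominator `suc d` is multiplied in and
-- cancelled.
cross-≤-< : ∀ a b c d e f → a * suc d ≤ b * suc c → b * suc f < e * suc d →
            a * suc f < e * suc c
cross-≤-< a b c d e f p q = *-cancelʳ-< (suc d) (a * suc f) (e * suc c) (begin-strict
  a * suc f * suc d   ≡⟨ swap a (suc f) (suc d) ⟩
  a * suc d * suc f   ≤⟨ *-monoˡ-≤ (suc f) p ⟩
  b * suc c * suc f   ≡⟨ swap b (suc c) (suc f) ⟩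
  b * suc f * suc c   <⟨ *-monoˡ-< (suc c) q ⟩
  e * suc d * suc c   ≡⟨ swap e (suc d) (suc c) ⟩
  e * suc c * suc d   ∎)
  where
  open ≤-Reasoning
  swap : ∀ x y z → x * y * z ≡ x * z * y
  swap = solve 3 (λ x y z → x :* y :* z := x :* z :* y) refl
    where open +-*-Solver

mediant-left : ∀ a b c d → a * d < b * c → a * (c + d) < (a + b) * c
mediant-left a b c d p = begin-strict
  a * (c + d)     ≡⟨ *-distribˡ-+ a c d ⟩
  a * c + a * d   <⟨ +-monoʳ-< (a * c) p ⟩
  a * c + b * c   ≡⟨ *-distribʳ-+ c a b ⟨
  (a + b) * c     ∎
  where open ≤-Reasoning

mediant-right : ∀ a b c d → a * d < b * c → (a + b) * d < b * (c + d)
mediant-right a b c d p = begin-strict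
  (a + b) * d     ≡⟨ *-distribʳ-+ d a b ⟩
  a * d + b * d   <⟨ +-monoˡ-< (b * d) p ⟩
  b * c + b * d   ≡⟨ *-distribˡ-+ b c d ⟨
  b * (c + d)     ∎
  where open ≤-Reasoning

below above : ℕ → ℕ
below v = ⟪ π₁ v , suc (π₂ v) ⟫
above v = ⟪ suc (π₁ v) , π₂ v ⟫

-- Numerators and denominators are stored minus one, so the extra `suc` makes the true ones add up.
mediant : ℕ → ℕ → ℕ
mediant u v = ⟪ π₁ u + suc (π₁ v) , π₂ u + suc (π₂ v) ⟫

opaque
  -- The number v stands for the positive rational (π₁ v + 1) / (π₂ v + 1).
  _<ᵠ_ _≤ᵠ_ : Rel ℕ 0ℓ
  v <ᵠ w = suc (π₁ v) * suc (π₂ w) < suc (π₁ w) * suc (π₂ v)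
  v ≤ᵠ w = suc (π₁ v) * suc (π₂ w) ≤ suc (π₁ w) * suc (π₂ v)

  <ᵠ-irrefl : ∀ {v} → ¬ (v <ᵠ v)
  <ᵠ-irrefl = <-irrefl refl

  <ᵠ⇔ : ∀ {v w} → v <ᵠ w ⇔ suc (π₁ v) * suc (π₂ w) < suc (π₁ w) * suc (π₂ v)
  <ᵠ⇔ = mk⇔ (λ p → p) (λ p → p)

  ≤ᵠ-<ᵠ-trans : ∀ {u v w} → u ≤ᵠ v → v <ᵠ w → u <ᵠ w
  ≤ᵠ-<ᵠ-trans {u} {v} {w} =
    cross-≤-< (suc (π₁ u)) (suc (π₁ v)) (π₂ u) (π₂ v) (suc (π₁ w)) (π₂ w)

  <ᵠ-trans : ∀ {u v w} → u <ᵠ v → v <ᵠ w → u <ᵠ w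
  <ᵠ-trans {u} {v} {w} p = ≤ᵠ-<ᵠ-trans {u} {v} {w} (<⇒≤ p)

  ≤ᵠ-total : ∀ u v → u ≤ᵠ v ⊎ v ≤ᵠ u
  ≤ᵠ-total u v = ≤-total (suc (π₁ u) * suc (π₂ v)) (suc (π₁ v) * suc (π₂ u))

  below<ᵠ : ∀ v → below v <ᵠ v
  below<ᵠ v = subst₂ (λ n d → suc n * suc (π₂ v) < suc (π₁ v) * suc d) (sym π₁-⟪⟫) (sym π₂-⟪⟫)
    (*-monoʳ-< (suc (π₁ v)) ≤-refl)

  <ᵠabove : ∀ v → v <ᵠ above v
  <ᵠabove v = subst₂ (λ n d → suc (π₁ v) * suc d < suc n * suc (π₂ v)) (sym π₁-⟪⟫) (sym π₂-⟪⟫)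
    (*-monoˡ-< (suc (π₂ v)) {suc (π₁ v)} ≤-refl)

  <ᵠmediant : ∀ {u v} → u <ᵠ v → u <ᵠ mediant u v
  <ᵠmediant {u} {v} p = subst₂ (λ n d → suc (π₁ u) * suc d < suc n * suc (π₂ u))
    (sym π₁-⟪⟫) (sym π₂-⟪⟫)
    (mediant-left (suc (π₁ u)) (suc (π₁ v)) (suc (π₂ u)) (suc (π₂ v)) p)

  mediant<ᵠ : ∀ {u v} → u <ᵠ v → mediant u v <ᵠ v
  mediant<ᵠ {u} {v} p = subst₂ (λ n d → suc n * suc (π₂ v) < suc (π₁ v) * suc d)
    (sym π₁-⟪⟫) (sym π₂-⟪⟫)
    (mediant-right (suc (π₁ u)) (suc (π₁ v)) (suc (π₂ u)) (suc (π₂ v)) p)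

-- A disjoint union of components, each a copy of the positive rationals (in
-- which every rational is repeated infinitely often) with an antichain of
-- tops above it.  The point ⟪ a , 0 ⟫ is the top number a, over the component
-- c a; the point ⟪ i , b ⟫ with b ≢ 0 is a copy of the rational π₁ b in the
-- component i.
data Forest (c : ℕ → ℕ) (x y : ℕ) : Set where
  inside : π₂ x ≢ 0 → π₂ y ≢ 0 → π₁ x ≡ π₁ y → π₁ (π₂ x) <ᵠ π₁ (π₂ y) → Forest c x y
  under  : π₂ x ≢ 0 → π₂ y ≡ 0 → c (π₁ y) ≡ π₁ x → Forest c x y

core : ℕ → ℕ → ℕ → ℕ
core i v e = ⟪ i , ⟪ v , suc e ⟫ ⟫

top : ℕ → ℕ
top a = ⟪ a , 0 ⟫

core-component : ∀ {i v e} → π₁ (core i v e) ≡ i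
core-component = π₁-⟪⟫

core-value : ∀ {i v e} → π₁ (π₂ (core i v e)) ≡ v
core-value = trans (cong π₁ π₂-⟪⟫) π₁-⟪⟫

core≢top : ∀ {i v e} → π₂ (core i v e) ≢ 0
core≢top {i} {v} {e} eq = <⇒≢ (≤-trans z<s snd≤⟪⟫) (trans (sym eq) π₂-⟪⟫)

module ForestProperties (c : ℕ → ℕ) where

  private
    infix 4 _≺_
    _≺_ : Rel ℕ 0ℓ
    _≺_ = Forest c

  ≺-irreflexive : Irreflexive _≡_ _≺_
  ≺-irreflexive refl (inside _ _ _ lt) = <ᵠ-irrefl lt
  ≺-irreflexive refl (under nz z _)    = nz z

  ≺-transitive : Transitive _≺_
  ≺-transitive (inside cx cy eq lt) (inside _ cz eq' lt') =
    inside cx cz (trans eq eq') (<ᵠ-trans lt lt')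
  ≺-transitive (inside cx cy eq lt) (under _ tz eq') = under cx tz (trans eq' (sym eq))
  ≺-transitive (under _ ty _) (inside cy _ _ _) = ⊥-elim (cy ty)
  ≺-transitive (under _ ty _) (under cy _ _) = ⊥-elim (cy ty)

  core≺ : ∀ {i v y} e → π₂ y ≢ 0 → i ≡ π₁ y → v <ᵠ π₁ (π₂ y) → core i v e ≺ y
  core≺ {y = y} e cy eq lt = inside core≢top cy (trans core-component eq)
    (subst (_<ᵠ π₁ (π₂ y)) (sym core-value) lt)

  ≺core : ∀ {x i v} e → π₂ x ≢ 0 → π₁ x ≡ i → π₁ (π₂ x) <ᵠ v → x ≺ core i v e
  ≺core {x} e cx eq lt = inside cx core≢top (trans eq (sym core-component))
    (subst (π₁ (π₂ x) <ᵠ_) (sym core-value) lt)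

  core≺top : ∀ {i v y} e → π₂ y ≡ 0 → c (π₁ y) ≡ i → core i v e ≺ y
  core≺top e ty eq = under core≢top ty (trans eq (sym core-component))

  ≺-nonempty : ∀ y → ∃ λ x → x ≺ y
  ≺-nonempty y with π₂ y ≟ 0
  ... | yes ty = core (c (π₁ y)) 0 0 , core≺top 0 ty refl
  ... | no cy  = core (π₁ y) (below (π₁ (π₂ y))) 0 , core≺ 0 cy refl (below<ᵠ (π₁ (π₂ y)))

  -- A point just above the larger value dominates both. Below a core point it must stay under the
  -- value of `y`, hence the mediant; below a top there is no such ceiling, hence `above`.
  ≺-directed-≤ᵠ : ∀ {y a b} → π₁ (π₂ a) ≤ᵠ π₁ (π₂ b) → a ≺ y → b ≺ y →
                  ∃ λ z → z ≺ y × a ≺ z × b ≺ z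
  ≺-directed-≤ᵠ {y} {a} {b} a≤b (inside ca cy ea la) (inside cb _ eb lb) =
    core (π₁ y) (mediant (π₁ (π₂ b)) (π₁ (π₂ y))) 0 , core≺ 0 cy refl (mediant<ᵠ lb) ,
    ≺core 0 ca ea (≤ᵠ-<ᵠ-trans a≤b (<ᵠmediant lb)) , ≺core 0 cb eb (<ᵠmediant lb)
  ≺-directed-≤ᵠ {y} {a} {b} a≤b (under ca ty ea) (under cb _ eb) =
    core (c (π₁ y)) (above (π₁ (π₂ b))) 0 , core≺top 0 ty refl ,
    ≺core 0 ca (sym ea) (≤ᵠ-<ᵠ-trans a≤b (<ᵠabove _)) , ≺core 0 cb (sym eb) (<ᵠabove _)
  ≺-directed-≤ᵠ _ (inside _ cy _ _) (under _ ty _) = ⊥-elim (cy ty)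
  ≺-directed-≤ᵠ _ (under _ ty _) (inside _ cy _ _) = ⊥-elim (cy ty)

  ≺-directed : ∀ {y a b} → a ≺ y → b ≺ y → ∃ λ z → z ≺ y × a ≺ z × b ≺ z
  ≺-directed {a = a} {b} p q with ≤ᵠ-total (π₁ (π₂ a)) (π₁ (π₂ b))
  ... | inj₁ a≤b = ≺-directed-≤ᵠ a≤b p q
  ... | inj₂ b≤a = let (z , z≺y , b≺z , a≺z) = ≺-directed-≤ᵠ b≤a q p in z , z≺y , a≺z , b≺z

  ≺-interpolable : Interpolable _≺_
  ≺-interpolable = record
    { transitive = ≺-transitive
    ; nonempty   = ≺-nonempty
    ; directed   = ≺-directed
    }

module _ (c c' : ℕ → ℕ) {σ τ : ℕ → ℕ}
         (σ-injective : Injective _≡_ _≡_ σ) (σ-surjective : StrictlySurjective _≡_ σ)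
         (τ-injective : Injective _≡_ _≡_ τ) (τ-surjective : StrictlySurjective _≡_ τ)
         (commute : ∀ a → c' (τ a) ≡ σ (c a)) where

  private
    move : ℕ → ℕ → ℕ
    move zero    = τ
    move (suc _) = σ

    move-injective : ∀ b {a a'} → move b a ≡ move b a' → a ≡ a'
    move-injective zero    = τ-injective
    move-injective (suc _) = σ-injective

    move-surjective : ∀ b a → ∃ λ a' → move b a' ≡ a
    move-surjective zero    = τ-surjective
    move-surjective (suc _) = σ-surjective

    move-top : ∀ {b a} → b ≡ 0 → move b a ≡ τ a
    move-top refl = refl

    move-core : ∀ {b a} → b ≢ 0 → move b a ≡ σ a
    move-core {zero}  nz = ⊥-elim (nz refl)
    move-core {suc _} nz = refl

    -- The second coordinate is kept: it tells tops from core points and holds the rational. Only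
    -- the names of components and tops are permuted.
    f : ℕ → ℕ
    f x = ⟪ move (π₂ x) (π₁ x) , π₂ x ⟫

    f-level : ∀ x → π₂ (f x) ≡ π₂ x
    f-level x = π₂-⟪⟫

    f-core : ∀ x → π₂ x ≢ 0 → π₁ (f x) ≡ σ (π₁ x)
    f-core x nz = trans π₁-⟪⟫ (move-core nz)

    f-top : ∀ x → π₂ x ≡ 0 → π₁ (f x) ≡ τ (π₁ x)
    f-top x z = trans π₁-⟪⟫ (move-top z)

    f-mono : ∀ {x y} → Forest c x y → Forest c' (f x) (f y)
    f-mono {x} {y} (inside cx cy eq lt) = inside
      (λ z → cx (trans (sym (f-level x)) z))
      (λ z → cy (trans (sym (f-level y)) z))
      (trans (f-core x cx) (trans (cong σ eq) (sym (f-core y cy))))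
      (subst₂ (λ b b' → π₁ b <ᵠ π₁ b') (sym (f-level x)) (sym (f-level y)) lt)
    f-mono {x} {y} (under cx ty eq) = under
      (λ z → cx (trans (sym (f-level x)) z))
      (trans (f-level y) ty)
      (trans (cong c' (f-top y ty)) (trans (commute (π₁ y)) (trans (cong σ eq) (sym (f-core x cx)))))

    f-cancel : ∀ {x y} → Forest c' (f x) (f y) → Forest c x y
    f-cancel {x} {y} (inside cx cy eq lt) = inside cx' cy'
      (σ-injective (trans (sym (f-core x cx')) (trans eq (f-core y cy'))))
      (subst₂ (λ b b' → π₁ b <ᵠ π₁ b') (f-level x) (f-level y) lt)
      where
      cx' : π₂ x ≢ 0
      cx' z = cx (trans (f-level x) z)
      cy' : π₂ y ≢ 0
      cy' z = cy (trans (f-level y) z)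
    f-cancel {x} {y} (under cx ty eq) = under cx' ty' (σ-injective (trans (sym (commute (π₁ y)))
      (trans (cong c' (sym (f-top y ty'))) (trans eq (f-core x cx')))))
      where
      cx' : π₂ x ≢ 0
      cx' z = cx (trans (f-level x) z)
      ty' : π₂ y ≡ 0
      ty' = trans (sym (f-level y)) ty

    f-injective : ∀ {x y} → f x ≡ f y → x ≡ y
    f-injective {x} {y} eq with ⟪⟫-injective eq
    ... | eq₁ , eq₂ = trans (sym (⟪⟫-η x)) (trans (cong₂ ⟪_,_⟫
      (move-injective (π₂ y) (subst (λ b → move b (π₁ x) ≡ move (π₂ y) (π₁ y)) eq₂ eq₁)) eq₂)
      (⟪⟫-η y))

    f-surjective : ∀ y → ∃ λ x → f x ≡ y
    f-surjective y with move-surjective (π₂ y) (π₁ y)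
    ... | a , eq = ⟪ a , π₂ y ⟫ , trans
      (cong₂ ⟪_,_⟫ (trans (cong₂ move π₂-⟪⟫ π₁-⟪⟫) eq) π₂-⟪⟫) (⟪⟫-η y)

  forest-≅ : Forest c ≅ Forest c'
  forest-≅ = f , record
    { isOrderMonomorphism = record
      { isOrderHomomorphism = record { cong = cong f ; mono = f-mono }
      ; injective = f-injective
      ; cancel = f-cancel
      }
    ; surjective = λ y → let (x , eq) = f-surjective y in x , λ { refl → eq }
    }

-- Isomorphism of forests

-- This replaces a back-and-forth argument: once each index has an invariant that determines it,
-- equality of invariants is the bijection.
matching : ∀ {D : Set} {u v : ℕ → D} → Injective _≡_ _≡_ u → Injective _≡_ _≡_ v →
           (∀ n → ∃ λ m → v m ≡ u n) → (∀ m → ∃ λ n → u n ≡ v m) →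
           ∃ λ σ → Injective _≡_ _≡_ σ × StrictlySurjective _≡_ σ × (∀ n → v (σ n) ≡ u n)
matching {u = u} {v} u-injective v-injective u⊆v v⊆u = σ ,
  (λ {n} {m} eq → u-injective (trans (sym (σ-correct n)) (trans (cong v eq) (σ-correct m)))) ,
  (λ m → let (n , eq) = v⊆u m in n , v-injective (trans (σ-correct n) eq)) ,
  σ-correct
  where
  σ : ℕ → ℕ
  σ n = proj₁ (u⊆v n)
  σ-correct : ∀ n → v (σ n) ≡ u n
  σ-correct n = proj₂ (u⊆v n)

module Rank (f : ℕ → ℕ) where

  Recurs : ℕ → Set
  Recurs c = ∀ n → ∃ λ m → n ≤ m × f m ≡ c

  -- The number of `m < n` with `f m ≡ c`. Restricted to the fibre of `f` over `c` it is injective,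
  -- and onto ℕ if the fibre is infinite.
  rank : ℕ → ℕ → ℕ
  rank c zero = 0
  rank c (suc n) with f n ≟ c
  ... | yes _ = suc (rank c n)
  ... | no _  = rank c n

  rank-hit : ∀ {c n} → f n ≡ c → rank c (suc n) ≡ suc (rank c n)
  rank-hit {c} {n} eq with f n ≟ c
  ... | yes _ = refl
  ... | no ≢c = ⊥-elim (≢c eq)

  rank-miss : ∀ {c n} → f n ≢ c → rank c (suc n) ≡ rank c n
  rank-miss {c} {n} ≢c with f n ≟ c
  ... | yes eq = ⊥-elim (≢c eq)
  ... | no _   = refl

  rank-suc : ∀ c n → rank c n ≤ rank c (suc n)
  rank-suc c n with f n ≟ c
  ... | yes _ = n≤1+n _
  ... | no _  = ≤-refl

  rank-mono : ∀ c n d → rank c n ≤ rank c (d + n)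
  rank-mono c n zero    = ≤-refl
  rank-mono c n (suc d) = ≤-trans (rank-mono c n d) (rank-suc c (d + n))

  rank-< : ∀ {c n m} → f n ≡ c → n < m → rank c n < rank c m
  rank-< {c} {n} {m} eq n<m = subst (λ k → rank c n < rank c k) (m∸n+n≡m n<m)
    (≤-trans (≤-reflexive (sym (rank-hit eq))) (rank-mono c (suc n) (m ∸ suc n)))

  rank-injective : ∀ {c n m} → f n ≡ c → f m ≡ c → rank c n ≡ rank c m → n ≡ m
  rank-injective {n = n} {m} p q eq with <-cmp n m
  ... | tri< n<m _ _ = ⊥-elim (<⇒≢ (rank-< p n<m) eq)
  ... | tri≈ _ n≡m _ = n≡m
  ... | tri> _ _ m<n = ⊥-elim (<⇒≢ (rank-< q m<n) (sym eq))

  -- The first hit from `n` on, with `d` bounding the search; the misses on the way leave the rank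
  -- unchanged.
  rank-next : ∀ {c} d n → f (d + n) ≡ c → ∃ λ m → f m ≡ c × rank c m ≡ rank c n
  rank-next {c} d n eq with f n ≟ c
  rank-next d n eq | yes hit = n , hit , refl
  rank-next zero n eq | no miss = ⊥-elim (miss eq)
  rank-next {c} (suc d) n eq | no miss =
    let (m , hit , same) = rank-next d (suc n) (trans (cong f (+-suc d n)) eq)
    in m , hit , trans same (rank-miss miss)

  rank-surjective : ∀ {c} → Recurs c → ∀ r → ∃ λ m → f m ≡ c × rank c m ≡ r
  rank-surjective rec zero =
    let (m , _ , eq) = rec 0 in rank-next m 0 (trans (cong f (+-identityʳ m)) eq)
  rank-surjective {c} rec (suc r) =
    let (n , hit , eq)  = rank-surjective rec r
        (m , n<m , eq') = rec (suc n)
        (k , hit' , eq″) = rank-next (m ∸ suc n) (suc n) (trans (cong f (m∸n+n≡m n<m)) eq')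
    in k , hit' , trans eq″ (trans (rank-hit hit) (cong suc eq))

-- Blueprints and the sizes of components

open Rank using (Recurs; rank; rank-injective; rank-surjective)

-- The component i of the forest has the tops ⟪ i , j ⟫ with j ≤ π₁ i, and
-- those with Extra i j.  The remaining tops are thrown onto the component
-- trash, which has infinitely many tops anyway.
record Blueprint (S : Pred ℕ 0ℓ) : Set₁ where
  field
    Extra    : ℕ → ℕ → Set
    upward   : ∀ {i j k} → j ≤ k → Extra i j → Extra i k
    sound    : ∀ i → (∀ j → ¬ Extra i j) → S (π₁ i)
    complete : ∀ {k} → S k → ∀ n → ∃ λ d → n ≤ d × (∀ j → ¬ Extra ⟪ k , d ⟫ j)
    excluded : ℕ
    ∉S       : ¬ S excluded

  trash : ℕ
  trash = ⟪ excluded , 0 ⟫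

  Present : ℕ → Set
  Present a = π₂ a < suc (π₁ (π₁ a)) ⊎ Extra (π₁ a) (π₂ a)

module Components (em : ExcludedMiddle 0ℓ) {S : Pred ℕ 0ℓ} (B : Blueprint S) where

  open Classical em
  open Blueprint B

  component : ℕ → ℕ
  component a with em {Present a}
  ... | yes _ = π₁ a
  ... | no _  = trash

  present⇒component : ∀ {a} → Present a → component a ≡ π₁ a
  present⇒component {a} p with em {Present a}
  ... | yes _ = refl
  ... | no ¬p = ⊥-elim (¬p p)

  absent⇒component : ∀ {a} → ¬ Present a → component a ≡ trash
  absent⇒component {a} ¬p with em {Present a}
  ... | yes p = ⊥-elim (¬p p)
  ... | no _  = refl

  -- 0 if the component i has infinitely many tops, otherwise their number.
  size : ℕ → ℕ
  size i with em {∃ λ j → Extra i j}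
  ... | yes _ = 0
  ... | no _  = suc (π₁ i)

  extra⇒size : ∀ {i j} → Extra i j → size i ≡ 0
  extra⇒size {i} {j} e with em {∃ λ j → Extra i j}
  ... | yes _ = refl
  ... | no ¬e = ⊥-elim (¬e (j , e))

  noextra⇒size : ∀ {i} → (∀ j → ¬ Extra i j) → size i ≡ suc (π₁ i)
  noextra⇒size {i} ¬e with em {∃ λ j → Extra i j}
  ... | yes (j , e) = ⊥-elim (¬e j e)
  ... | no _        = refl

  size⇒extra : ∀ {i} → size i ≡ 0 → ∃ λ j → Extra i j
  size⇒extra {i} eq with em {∃ λ j → Extra i j}
  ... | yes e = e

  size⇒noextra : ∀ {i k} → size i ≡ suc k → (∀ j → ¬ Extra i j) × π₁ i ≡ k
  size⇒noextra {i} eq with em {∃ λ j → Extra i j}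
  ... | no ¬e = (λ j e → ¬e (j , e)) , suc-injective eq

  ∉S⇒extra : ∀ i → ¬ S (π₁ i) → ∃ λ j → Extra i j
  ∉S⇒extra i ¬s = stable (λ none → ¬s (sound i (λ j e → none (j , e))))

  infinite : ∀ {i} → size i ≡ 0 → Recurs component i
  infinite {i} eq n =
    let (j , e) = size⇒extra eq
        a = ⟪ i , n + j ⟫
    in a , ≤-trans (m≤m+n n j) snd≤⟪⟫ ,
       trans (present⇒component {a} (inj₂ (subst₂ Extra (sym π₁-⟪⟫) (sym π₂-⟪⟫) (upward (m≤n+m j n) e))))
             π₁-⟪⟫

  ∈finite : ∀ {a i k} → size i ≡ suc k → component a ≡ i → π₁ a ≡ i × π₂ a ≤ k
  ∈finite {a} eq c≡ with size⇒noextra eq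
  ... | ¬e , refl with em {Present a}
  ∈finite {a} eq refl | ¬e , refl | yes (inj₁ j<) = refl , s≤s⁻¹ j<
  ∈finite {a} eq refl | ¬e , refl | yes (inj₂ e) = ⊥-elim (¬e _ e)
  -- An absent top lies over `trash`, which has extra tops because `excluded` is outside `S`; so
  -- `trash` is not a finite component.
  ∈finite {a} eq refl | ¬e , refl | no _ =
    let (j , e) = ∉S⇒extra trash (λ s → ∉S (subst S π₁-⟪⟫ s)) in ⊥-elim (¬e j e)

  finite∋ : ∀ {i k j} → size i ≡ suc k → j ≤ k → component ⟪ i , j ⟫ ≡ i
  finite∋ {i} {k} {j} eq j≤k = trans (present⇒component (inj₁ (s≤s bound))) π₁-⟪⟫
    where
    bound : π₂ ⟪ i , j ⟫ ≤ π₁ (π₁ ⟪ i , j ⟫)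
    bound = subst₂ _≤_ (sym π₂-⟪⟫) (trans (sym (proj₂ (size⇒noextra eq))) (cong π₁ (sym π₁-⟪⟫))) j≤k

  -- Numbers the tops over one component so that components of equal size use the same labels: all
  -- of ℕ in the infinite case, and 0 to k in the finite case, where `π₂` already does it.
  labelIn : ℕ → ℕ → ℕ
  labelIn zero    a = rank component (component a) a
  labelIn (suc _) a = π₂ a

  label : ℕ → ℕ
  label a = labelIn (size (component a)) a

  label-injective : ∀ {a b} → component a ≡ component b → label a ≡ label b → a ≡ b
  label-injective {a} {b} eq leq = bySize (size (component a)) refl
    where
    labels : ∀ s → size (component a) ≡ s → labelIn s a ≡ labelIn s b
    labels s eq' = trans (sym (cong (λ s → labelIn s a) eq')) (trans leq
      (cong (λ s → labelIn s b) (trans (cong size (sym eq)) eq')))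
    bySize : ∀ s → size (component a) ≡ s → a ≡ b
    bySize zero eq' = rank-injective component refl (sym eq)
      (trans (labels 0 eq') (cong (λ c → rank component c b) (sym eq)))
    bySize (suc k) eq' = trans (sym (⟪⟫-η a)) (trans (cong₂ ⟪_,_⟫
      (trans (proj₁ (∈finite eq' refl))
        (trans eq (sym (proj₁ (∈finite (trans (cong size (sym eq)) eq') refl)))))
      (labels (suc k) eq')) (⟪⟫-η b))

  -- Every component with first coordinate `excluded` has extra tops, whatever its second
  -- coordinate.
  size-recurs-0 : Recurs size 0
  size-recurs-0 n =
    let (j , e) = ∉S⇒extra ⟪ excluded , n ⟫ (λ s → ∉S (subst S π₁-⟪⟫ s))
    in ⟪ excluded , n ⟫ , snd≤⟪⟫ , extra⇒size e

  size-recurs-suc : ∀ {k} → S k → Recurs size (suc k)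
  size-recurs-suc {k} s n = let (d , n≤d , ¬e) = complete s n in
    ⟪ k , d ⟫ , ≤-trans n≤d snd≤⟪⟫ , trans (noextra⇒size ¬e) (cong suc π₁-⟪⟫)

  size∈S : ∀ {i k} → size i ≡ suc k → S k
  size∈S {i} eq = let (¬e , π≡) = size⇒noextra eq in subst S π≡ (sound i ¬e)

module _ (em : ExcludedMiddle 0ℓ) {S : Pred ℕ 0ℓ} where

  open Components em

  size-recurs : (B C : Blueprint S) → ∀ i → Recurs (size C) (size B i)
  size-recurs B C i with size B i in eq
  ... | zero  = size-recurs-0 C
  ... | suc k = size-recurs-suc C (size∈S B eq)

  counterpart : (B C : Blueprint S) → ∀ a i → size C i ≡ size B (component B a) →
                ∃ λ a' → component C a' ≡ i × label C a' ≡ label B a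
  counterpart B C a i eq = bySize (size B (component B a)) refl
    where
    bySize : ∀ s → size B (component B a) ≡ s → ∃ λ a' → component C a' ≡ i × label C a' ≡ label B a
    bySize zero eqs with rank-surjective (component C) (infinite C (trans eq eqs))
                           (rank (component B) (component B a) a)
    ... | a' , refl , same = a' , refl ,
      trans (cong (λ s → labelIn C s a') (trans eq eqs))
        (trans same (cong (λ s → labelIn B s a) (sym eqs)))
    bySize (suc k) eqs = ⟪ i , π₂ a ⟫ , inPlace ,
      trans (cong (λ s → labelIn C s ⟪ i , π₂ a ⟫) (trans (cong (size C) inPlace) (trans eq eqs)))
        (trans π₂-⟪⟫ (cong (λ s → labelIn B s a) (sym eqs)))
      where
      inPlace : component C ⟪ i , π₂ a ⟫ ≡ i
      inPlace = finite∋ C (trans eq eqs) (proj₂ (∈finite B eqs refl))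

  -- Components of equal size are told apart by counting them. As every size that occurs recurs
  -- forever, and the same sizes occur in all blueprints of `S`, so do the same signatures.
  signature : Blueprint S → ℕ → ℕ × ℕ
  signature B i = size B i , rank (size B) (size B i) i

  signature-injective : ∀ B → Injective _≡_ _≡_ (signature B)
  signature-injective B {i} {j} eq = rank-injective (size B) refl (sym (cong proj₁ eq))
    (trans (cong proj₂ eq) (cong (λ s → rank (size B) s j) (sym (cong proj₁ eq))))

  signature⊆ : ∀ B C i → ∃ λ j → signature C j ≡ signature B i
  signature⊆ B C i with rank-surjective (size C) (size-recurs B C i) (rank (size B) (size B i) i)
  ... | j , eq , same = j , cong₂ _,_ eq (trans (cong (λ s → rank (size C) s j) eq) same)

  blueprints-≅ : (B C : Blueprint S) → Forest (component B) ≅ Forest (component C)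
  blueprints-≅ B C with matching (signature-injective B) (signature-injective C)
                          (signature⊆ B C) (signature⊆ C B)
  ... | σ , σ-injective , σ-surjective , σ-signature =
    let (τ , τ-injective , τ-surjective , τ-correct) = matching u-injective v-injective u⊆v v⊆u
    in forest-≅ (component B) (component C) σ-injective σ-surjective τ-injective τ-surjective
         (λ a → cong proj₁ (τ-correct a))
    where
    σ-size : ∀ i → size C (σ i) ≡ size B i
    σ-size i = cong proj₁ (σ-signature i)
    u v : ℕ → ℕ × ℕ
    -- The first coordinates force `τ` to lie over `σ`, which is the `commute` condition of
    -- `forest-≅`.
    u a = σ (component B a) , label B a
    v a = component C a , label C a
    u-injective : Injective _≡_ _≡_ u
    u-injective eq = label-injective B (σ-injective (cong proj₁ eq)) (cong proj₂ eq)
    v-injective : Injective _≡_ _≡_ v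
    v-injective eq = label-injective C (cong proj₁ eq) (cong proj₂ eq)
    u⊆v : ∀ a → ∃ λ a' → v a' ≡ u a
    u⊆v a with counterpart B C a (σ (component B a)) (σ-size (component B a))
    ... | a' , eq , leq = a' , cong₂ _,_ eq leq
    v⊆u : ∀ a → ∃ λ a' → u a' ≡ v a
    v⊆u a with σ-surjective (component C a)
    ... | i , σi≡ with counterpart C B a i (trans (sym (σ-size i)) (cong (size C) σi≡))
    ... | a' , eq , leq = a' , cong₂ _,_ (trans (cong σ eq) σi≡) leq

-- A copy computable in X

oracle≤T : ∀ {X} → X ≤T X
oracle≤T = oracle , λ x → yes⇓ , no⇓

module _ (em : ExcludedMiddle 0ℓ) {X S : Pred ℕ 0ℓ} (φ : Formula 3)
         (φ-correct : ∀ k → S k ⇔ ∃ λ W → ∀ t → Holds X (k ∷ W ∷ t ∷ []) φ)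
         (S≢ℕ : ∃ λ k → ¬ S k) where

  open Classical em

  -- The component ⟪ k , ⟪ W , d ⟫ ⟫ tests the witness W of k; d is a dummy.
  blueprint : Blueprint S
  blueprint = record
    { Extra    = λ i j → ∃ λ t → t < suc j × ¬ Holds X (π₁ i ∷ π₁ (π₂ i) ∷ t ∷ []) φ
    ; upward   = λ j≤k (t , t<1+j , ¬h) → t , ≤-trans t<1+j (s≤s j≤k) , ¬h
    ; sound    = λ i none → from (φ-correct (π₁ i))
                   (π₁ (π₂ i) , λ t → stable (λ ¬h → none t (t , ≤-refl , ¬h)))
    ; complete = λ {k} s n → let (W , h) = to (φ-correct k) s in
                   ⟪ W , n ⟫ , snd≤⟪⟫ , λ j (t , _ , ¬h) →
                   ¬h (subst₂ (λ k W → Holds X (k ∷ W ∷ t ∷ []) φ) (sym π₁-⟪⟫)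
                        (sym (trans (cong π₁ π₂-⟪⟫) π₁-⟪⟫)) (h t))
    ; excluded = proj₁ S≢ℕ
    ; ∉S       = proj₂ S≢ℕ
    }

  open Blueprint blueprint using (Present; trash)
  open Components em blueprint

  -- Whether a component is finite is not decidable in `X`, but whether a given top is present is:
  -- `Extra` looks for a failure only up to the number `j` of that top.
  presentᶠ : Formula 1
  presentᶠ = snd (var (# 0)) ≺̇ sucᵗ (fst (fst (var (# 0)))) ∨̇
    ex< (sucᵗ (snd (var (# 0))))
      (¬̇ substitute φ (fst (fst (var (# 1))) ∷ fst (snd (fst (var (# 1)))) ∷ var (# 0) ∷ []))

  forestᶠ : Formula 1
  forestᶠ = ¬̇ snd x ≐ lit 0 ∧̇
    (¬̇ snd y ≐ lit 0 ∧̇ fst x ≐ fst y ∧̇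
       sucᵗ (fst v) ⊗ sucᵗ (snd w) ≺̇ sucᵗ (fst w) ⊗ sucᵗ (snd v)
     ∨̇ snd y ≐ lit 0 ∧̇
       (substitute presentᶠ (fst y ∷ []) ∧̇ fst (fst y) ≐ fst x
        ∨̇ ¬̇ substitute presentᶠ (fst y ∷ []) ∧̇ lit trash ≐ fst x))
    where
    x y v w : Term 1
    x = fst (var (# 0))
    y = snd (var (# 0))
    v = fst (snd x)
    w = fst (snd y)

  forestᶠ-correct : ∀ z → Holds X (z ∷ []) forestᶠ ⇔ Forest component (π₁ z) (π₂ z)
  forestᶠ-correct z = mk⇔ forward backward
    where
    forward : Holds X (z ∷ []) forestᶠ → Forest component (π₁ z) (π₂ z)
    forward (cx , inj₁ (cy , eq , lt)) = inside cx cy eq (from <ᵠ⇔ lt)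
    forward (cx , inj₂ (ty , inj₁ (p , eq))) = under cx ty (trans (present⇒component {π₁ (π₂ z)} p) eq)
    forward (cx , inj₂ (ty , inj₂ (¬p , eq))) = under cx ty (trans (absent⇒component {π₁ (π₂ z)} ¬p) eq)
    backward : Forest component (π₁ z) (π₂ z) → Holds X (z ∷ []) forestᶠ
    backward (inside cx cy eq lt) = cx , inj₁ (cy , eq , to <ᵠ⇔ lt)
    backward (under cx ty eq) = cx , inj₂ (ty , split em)
      where
      split : Dec (Present (π₁ (π₂ z))) → _
      split (yes p) = inj₁ (p , trans (sym (present⇒component {π₁ (π₂ z)} p)) eq)
      split (no ¬p) = inj₂ (¬p , trans (sym (absent⇒component {π₁ (π₂ z)} ¬p)) eq)

  forest-computable : X -computable Forest component
  forest-computable = let (c , decides) = definable⇒≤T oracle≤T forestᶠ in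
    c , λ z → decide-⇔ (forestᶠ-correct z) (decides z)

module _ (em : ExcludedMiddle 0ℓ) {S : Pred ℕ 0ℓ} (S≢ℕ : ∃ λ k → ¬ S k) where

  open Classical em

  -- Depends on `S` alone, so it yields one order for all `X`. It settles membership in `S`
  -- outright, at no regard to computability, since the order of the theorem serves only as an
  -- isomorphism type.
  canonical : Blueprint S
  canonical = record
    { Extra    = λ i _ → ¬ S (π₁ i)
    ; upward   = λ _ ¬s → ¬s
    ; sound    = λ i none → stable (none 0)
    ; complete = λ s n → n , ≤-refl , λ _ ¬s → ¬s (subst S (sym π₁-⟪⟫) s)
    ; excluded = proj₁ S≢ℕ
    ; ∉S       = proj₂ S≢ℕ
    }

-- Sizes recovered from antichains

-- The points above q that are incomparable with m.  In a forest these are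
-- the tops of a component if m is a top, and infinitely many otherwise.
Cluster : Rel ℕ 0ℓ → ℕ → ℕ → ℕ → Set
Cluster _≺_ q m z = q ≺ z × ¬ z ≺ m × ¬ m ≺ z

-- Only `covers` ranges over all points; for a given list the other fields are bounded, so the whole
-- is Π₁ in the order.
record Counts (_≺_ : Rel ℕ 0ℓ) (k q m : ℕ) (s : ℕ → ℕ) : Set where
  constructor counts
  field
    base    : q ≺ m
    members : ∀ i → i < suc k → Cluster _≺_ q m (s i)
    unique  : ∀ i → i < suc k → ∀ j → j < suc k → s i ≡ s j → i ≡ j
    covers  : ∀ z → Cluster _≺_ q m z → ∃ λ i → i < suc k × s i ≡ z

-- Phrased in the order alone, without reference to the coding of points, and hence readable in any
-- isomorphic copy.
HasCluster : Rel ℕ 0ℓ → ℕ → Set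
HasCluster _≺_ k = ∃ λ q → ∃₂ λ m s → Counts _≺_ k q m s

module _ {_≺_ _≺'_ : Rel ℕ 0ℓ} {f g : ℕ → ℕ} (gf : ∀ x → g (f x) ≡ x) (fg : ∀ y → f (g y) ≡ y)
         (f-mono : ∀ {x y} → x ≺ y → f x ≺' f y) (g-mono : ∀ {x y} → x ≺' y → g x ≺ g y) where

  transport-cluster : ∀ {k} → HasCluster _≺_ k → HasCluster _≺'_ k
  transport-cluster {k} (q , m , s , counts q≺m members unique covers) =
    f q , f m , (λ i → f (s i)) , record
      { base    = f-mono q≺m
      ; members = λ i i<k → let (a , b , c) = members i i<k in
          f-mono a , (λ p → b (reflect p)) , (λ p → c (reflect p))
      ; unique  = λ i i<k j j<k eq →
          unique i i<k j j<k (trans (sym (gf (s i))) (trans (cong g eq) (gf (s j))))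
      ; covers  = λ z (a , b , c) →
          let (i , i<k , eq) = covers (g z)
                (subst (_≺ g z) (gf q) (g-mono a) ,
                 (λ p → b (subst (_≺' f m) (fg z) (f-mono p))) ,
                 (λ p → c (subst (f m ≺'_) (fg z) (f-mono p))))
          in i , i<k , trans (cong f eq) (fg z)
      }
    where
    reflect : ∀ {x y} → f x ≺' f y → x ≺ y
    reflect {x} {y} p = subst₂ _≺_ (gf x) (gf y) (g-mono p)

-- The pigeonhole principle, carried over from `Fin` to initial segments of ℕ.
covered⇒≤ : ∀ {n m} (h s : ℕ → ℕ) → (∀ e → e < n → ∃ λ i → i < m × s i ≡ h e) →
            (∀ e → e < n → ∀ e' → e' < n → h e ≡ h e' → e ≡ e') → n ≤ m
covered⇒≤ {n} {m} h s cover h-injective = injective⇒≤ {f = position} position-injective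
  where
  at : (e : Fin n) → ∃ λ i → i < m × s i ≡ h (toℕ e)
  at e = cover (toℕ e) (toℕ<n e)
  position : Fin n → Fin m
  position e = fromℕ< (proj₁ (proj₂ (at e)))
  position-injective : Injective _≡_ _≡_ position
  position-injective {e} {e'} eq = toℕ-injective (h-injective _ (toℕ<n e) _ (toℕ<n e')
    (trans (sym (proj₂ (proj₂ (at e)))) (trans
      (cong s (fromℕ<-injective _ _ _ _ eq)) (proj₂ (proj₂ (at e'))))))

module _ (em : ExcludedMiddle 0ℓ) {S : Pred ℕ 0ℓ} (B : Blueprint S) where

  open Components em B
  open Blueprint B using (complete)
  open ForestProperties component

  private
    infix 4 _≺_
    _≺_ : Rel ℕ 0ℓ
    _≺_ = Forest component

  top-eta : ∀ {z} → π₂ z ≡ 0 → top (π₁ z) ≡ z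
  top-eta {z} eq = trans (cong ⟪ π₁ z ,_⟫ (sym eq)) (⟪⟫-η z)

  ¬top≺ : ∀ {x y} → π₂ x ≡ 0 → ¬ x ≺ y
  ¬top≺ tx (inside cx _ _ _) = cx tx
  ¬top≺ tx (under cx _ _)    = cx tx

  ≺top : ∀ {x a} → π₂ x ≢ 0 → component a ≡ π₁ x → x ≺ top a
  ≺top cx eq = under cx π₂-⟪⟫ (trans (cong component π₁-⟪⟫) eq)

  member⇒cluster : ∀ {q m} → q ≺ m → π₂ m ≡ 0 → ∀ {a} → component a ≡ π₁ q → Cluster _≺_ q m (top a)
  member⇒cluster q≺m tm eq = ≺top (core-left q≺m) eq , ¬top≺ π₂-⟪⟫ , ¬top≺ tm
    where
    core-left : ∀ {x y} → x ≺ y → π₂ x ≢ 0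
    core-left (inside cx _ _ _) = cx
    core-left (under cx _ _)    = cx

  cluster⇒member : ∀ {q m z} → π₂ m ≡ 0 → component (π₁ m) ≡ π₁ q → Cluster _≺_ q m z →
                   π₂ z ≡ 0 × component (π₁ z) ≡ π₁ q
  cluster⇒member tm eq (inside _ cz eq' _ , ¬z≺m , _) = ⊥-elim (¬z≺m (under cz tm (trans eq eq')))
  cluster⇒member tm eq (under _ tz eq' , _) = tz , eq'

  S⇒cluster : ∀ {k} → S k → HasCluster _≺_ k
  S⇒cluster {k} s with complete s 0
  ... | d , _ , ¬e = q , m , (λ j → top ⟪ i , j ⟫) , record
    { base    = q≺m
    ; members = λ j j<1+k → member⇒cluster q≺m π₂-⟪⟫
        (trans (finite∋ size≡ (s≤s⁻¹ j<1+k)) (sym core-component))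
    ; unique  = λ j _ j' _ eq → proj₂ (⟪⟫-injective (proj₁ (⟪⟫-injective eq)))
    ; covers  = λ z C → let
        (tz , cz) = cluster⇒member π₂-⟪⟫
          (trans (cong component π₁-⟪⟫) (trans (finite∋ size≡ z≤n) (sym core-component))) C
        (p , b) = ∈finite size≡ (trans cz core-component)
        in π₂ (π₁ z) , s≤s b ,
           trans (cong top (trans (cong ⟪_, π₂ (π₁ z) ⟫ (sym p)) (⟪⟫-η (π₁ z)))) (top-eta tz)
    }
    where
    i q m : ℕ
    i = ⟪ k , d ⟫
    q = core i 0 0
    m = top ⟪ i , 0 ⟫
    size≡ : size i ≡ suc k
    size≡ = trans (noextra⇒size ¬e) (cong suc π₁-⟪⟫)
    q≺m : q ≺ m
    q≺m = ≺top core≢top (trans (finite∋ size≡ z≤n) (sym core-component))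

  -- If `m` is a core point, its rational has infinitely many copies above `q`, too many for the
  -- list; the repetition of rationals serves this case. If `m` is a top, the cluster consists of
  -- all tops over the component of `q`, which is therefore finite, and its size determines `k`.
  cluster⇒S : ∀ {k} → HasCluster _≺_ k → S k
  cluster⇒S {k} (q , m , s , counts q≺m@(inside cq cm eq lt) members unique covers) =
    ⊥-elim (1+n≰n (covered⇒≤ copy s (λ e _ → covers (copy e) (copy∈ e))
      (λ e _ e' _ eq → suc-injective (proj₂ (⟪⟫-injective (proj₂ (⟪⟫-injective eq)))))))
    where
    copy : ℕ → ℕ
    copy e = core (π₁ m) (π₁ (π₂ m)) e
    copy∈ : ∀ e → Cluster _≺_ q m (copy e)
    copy∈ e = ≺core e cq eq lt ,
      (λ { (inside _ _ _ lt) → <ᵠ-irrefl (subst (_<ᵠ π₁ (π₂ m)) core-value lt)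
         ; (under _ tm _) → cm tm }) ,
      (λ { (inside _ _ _ lt) → <ᵠ-irrefl (subst (π₁ (π₂ m) <ᵠ_) core-value lt)
         ; (under _ tz _) → core≢top tz })
  cluster⇒S {k} (q , m , s , counts q≺m@(under cq tm cm) members unique covers) =
    bySize (size (π₁ q)) refl
    where
    bySize : ∀ n → size (π₁ q) ≡ n → S k
    bySize zero eq = ⊥-elim (1+n≰n (covered⇒≤ (λ r → top (nthTop r)) s
      (λ r _ → covers _ (member⇒cluster q≺m tm (proj₁ (proj₂ (tops r)))))
      (λ r _ r' _ eq → trans (sym (proj₂ (proj₂ (tops r)))) (trans
        (cong (rank component (π₁ q)) (proj₁ (⟪⟫-injective eq))) (proj₂ (proj₂ (tops r')))))))
      where
      tops : ∀ r → ∃ λ a → component a ≡ π₁ q × rank component (π₁ q) a ≡ r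
      tops = rank-surjective component (infinite eq)
      nthTop : ℕ → ℕ
      nthTop r = proj₁ (tops r)
    bySize (suc k') eq = subst S (suc-injective (≤-antisym
      (covered⇒≤ (λ j → top ⟪ π₁ q , j ⟫) s
        (λ j j<k' → covers _ (member⇒cluster q≺m tm (finite∋ eq (s≤s⁻¹ j<k'))))
        (λ j _ j' _ eq → proj₂ (⟪⟫-injective (proj₁ (⟪⟫-injective eq)))))
      (covered⇒≤ s (λ j → top ⟪ π₁ q , j ⟫) locate unique))) (size∈S eq)
      where
      locate : ∀ i → i < suc k → ∃ λ j → j < suc k' × top ⟪ π₁ q , j ⟫ ≡ s i
      locate i i<1+k = let
        (tz , cz) = cluster⇒member tm cm (members i i<1+k)
        (p , b) = ∈finite eq cz
        in π₂ (π₁ (s i)) , s≤s b ,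
           trans (cong top (trans (cong ⟪_, π₂ (π₁ (s i)) ⟫ (sym p)) (⟪⟫-η (π₁ (s i))))) (top-eta tz)

-- Recovering A from a copy

-- The jump runs a program on its own index. Here the parameter `p` is built into the program, which
-- ignores its input.
search : Program → ℕ → Program
search g p = comp (μ g) (constant p)

-- An instance of the s-m-n theorem: the nested index of `constant p` is rebuilt from `p` by
-- primitive recursion.
searchIndex : Program → Program
searchIndex g = pair (constant 6) (pair (constant (encode (μ g))) (comp constantIndex (pair zer identity)))
  where
  constantIndex : Program
  constantIndex = prec (constant (encode zer)) (pair (constant 6) (pair (constant (encode succ)) value))

opaque
  unfolding ⟪_,_⟫

  encode-comp : ∀ f g → encode (comp f g) ≡ ⟪ 6 , ⟪ encode f , encode g ⟫ ⟫
  encode-comp f g = refl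

searchIndex⇓ : ∀ {Y} g p → Y ⊢ searchIndex g · p ⇓ encode (search g p)
searchIndex⇓ {Y} g p = cast⇓ (sym (encode-comp (μ g) (constant p)))
  (pair⟪⟫⇓ (constant⇓ 6) (pair⟪⟫⇓ (constant⇓ (encode (μ g)))
    (comp⇓ (pair⟪⟫⇓ zer⇓ identity⇓) (prec⇓ (λ n → encode (constant n)) (constant⇓ (encode zer))
      (λ n → cast⇓ (sym (encode-comp succ (constant n)))
        (pair⟪⟫⇓ (constant⇓ 6) (pair⟪⟫⇓ (constant⇓ (encode succ)) value⇓))) p))))

module _ (em : ExcludedMiddle 0ℓ) where

  open Classical em

  least : ∀ {P : ℕ → Set} n → P n → ∃ λ m → P m × (∀ k → k < m → ¬ P k)
  least {P} n p with em {P 0}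
  ... | yes p₀ = 0 , p₀ , λ _ ()
  least {P} zero p | no ¬p₀ = ⊥-elim (¬p₀ p)
  least {P} (suc n) p | no ¬p₀ = let (m , pm , below) = least {λ k → P (suc k)} n p in
    suc m , pm , λ { zero _ → ¬p₀ ; (suc k) (s≤s k<m) → below k k<m }

  module _ {X : Pred ℕ 0ℓ} {D : ℕ → ℕ → Set} {g : Program}
           (g-decides : ∀ p z → X ⊢ g · ⟪ p , z ⟫ ⇓? D p z) where

    -- On a false instance `g` returns 0, the value that `μ` looks for; on the instances before the
    -- first false one it returns 1.
    search-halts : ∀ p → (X ′) (encode (search g p)) ⇔ (∃ λ z → ¬ D p z)
    search-halts p = mk⇔
      (λ (y , d) → y , diverge (subst (λ c → X ⊢ c · encode (search g p) ⇓ y) (decode-encode (search g p)) d))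
      (λ (z , ¬d) → let (z , ¬d , below) = least z ¬d in
        z , subst (λ c → X ⊢ c · encode (search g p) ⇓ z) (sym (decode-encode (search g p)))
          (comp⇓ (constant⇓ p) (μ⟪⟫⇓ (proj₂ (g-decides p z) ¬d)
            (λ m m<z → 0 , proj₁ (g-decides p m) (stable (below m m<z))))))
      where
      diverge : ∀ {e y} → X ⊢ search g p · e ⇓ y → ¬ D p y
      diverge (comp⇓ d (μ⇓ {a = a} {n} root _)) with deterministic d (constant⇓ p)
      ... | refl = λ holds → 0≢1+n (deterministic root
        (subst (λ x → X ⊢ g · x ⇓ 1) ⟪⟫≡⟨⟩ (proj₁ (g-decides p n) holds)))

    -- A ∀-question about X is a negative query to X ′.
    decide-∀ : ∀ p → (∀ z → D p z) → X ′ ⊢ comp oracle (searchIndex g) · p ⇓ 0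
    decide-∀ p all = comp⇓ (searchIndex⇓ g p)
      (no⇓ (λ h → let (z , ¬d) = to (search-halts p) h in ¬d (all z)))

    decide-¬∀ : ∀ p → ¬ (∀ z → D p z) → X ′ ⊢ comp oracle (searchIndex g) · p ⇓ 1
    decide-¬∀ p ¬all = comp⇓ (searchIndex⇓ g p) (yes⇓ (from (search-halts p) (counterexample ¬all)))

    -- A is decided by searching for a witness of A or of its complement.
    search-join : ∀ {A : Pred ℕ 0ℓ} →
                  (∀ {n v} → (∀ z → D ⟪ n , v ⟫ z) → Join A ⟪ n , π₁ v ⟫) →
                  (∀ {n b} → Join A ⟪ n , b ⟫ → ∃ λ v → ∀ z → D ⟪ n , v ⟫ z) → A ≤T X ′
    search-join {A} witness⇒join join⇒witness =
      -- The first component of the least witness is the tag of the join: 0 on the side of `A`,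
      -- non-zero on that of the complement.
      comp isZero (comp left (μ (comp oracle (searchIndex g)))) , λ n →
        (λ a → output (accept n a)) , (λ ¬a → output (reject n ¬a))
      where
      join₀ : ∀ {n} → A n → Join A ⟪ n , 0 ⟫
      join₀ a = inj₁ (π₂-⟪⟫ , subst A (sym π₁-⟪⟫) a)
      join₁ : ∀ {n} → ¬ A n → Join A ⟪ n , 1 ⟫
      join₁ ¬a = inj₂ ((λ eq → 1+n≢0 (trans (sym π₂-⟪⟫) eq)) , λ a → ¬a (subst A π₁-⟪⟫ a))
      someWitness : ∀ n → ∃ λ v → ∀ z → D ⟪ n , v ⟫ z
      someWitness n with em {A n}
      ... | yes a = join⇒witness (join₀ a)
      ... | no ¬a = join⇒witness (join₁ ¬a)
      leastWitness : ∀ n → ∃ λ v → (∀ z → D ⟪ n , v ⟫ z) × (∀ k → k < v → ¬ (∀ z → D ⟪ n , k ⟫ z))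
      leastWitness n = let (v , w) = someWitness n in least v w
      found : ∀ n → X ′ ⊢ μ (comp oracle (searchIndex g)) · n ⇓ proj₁ (leastWitness n)
      found n = let (v , w , below) = leastWitness n in
        μ⟪⟫⇓ (decide-∀ _ w) (λ k k<v → 0 , decide-¬∀ _ (below k k<v))
      output : ∀ {n y} → isZeroℕ (π₁ (proj₁ (leastWitness n))) ≡ y →
               X ′ ⊢ comp isZero (comp left (μ (comp oracle (searchIndex g)))) · n ⇓ y
      output {n} refl = comp⇓ (comp⇓ (found n) (left⇓ {x = proj₁ (leastWitness n)})) (isZero⇓ _)
      isZero-≢0 : ∀ {n} → n ≢ 0 → isZeroℕ n ≡ 0
      isZero-≢0 {zero}  nz = ⊥-elim (nz refl)
      isZero-≢0 {suc _} nz = refl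
      accept : ∀ n → A n → isZeroℕ (π₁ (proj₁ (leastWitness n))) ≡ 1
      accept n a with witness⇒join (proj₁ (proj₂ (leastWitness n)))
      ... | inj₁ (eq , _) = cong isZeroℕ (trans (sym π₂-⟪⟫) eq)
      ... | inj₂ (_ , ¬a) = ⊥-elim (¬a (subst A (sym π₁-⟪⟫) a))
      reject : ∀ n → ¬ A n → isZeroℕ (π₁ (proj₁ (leastWitness n))) ≡ 0
      reject n ¬a with witness⇒join (proj₁ (proj₂ (leastWitness n)))
      ... | inj₁ (_ , a) = ⊥-elim (¬a (subst A π₁-⟪⟫ a))
      ... | inj₂ (nz , _) = isZero-≢0 (λ eq → nz (trans π₂-⟪⟫ eq))

clusterᶠ : Formula 3
clusterᶠ = rel (pr (var (# 0)) (var (# 2))) ∧̇ ¬̇ rel (pr (var (# 2)) (var (# 1))) ∧̇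
  ¬̇ rel (pr (var (# 1)) (var (# 2)))

opaque
  -- Variables: k, q, m, a list s and a point z to be covered.
  countsᶠ : Formula 5
  countsᶠ =
    rel (pr (var (# 1)) (var (# 2))) ∧̇
    all< (sucᵗ (var (# 0))) (substitute clusterᶠ (var (# 2) ∷ var (# 3) ∷ entry (var (# 4)) (var (# 0)) ∷ [])) ∧̇
    all< (sucᵗ (var (# 0))) (all< (sucᵗ (var (# 1)))
      (¬̇ entry (var (# 5)) (var (# 1)) ≐ entry (var (# 5)) (var (# 0)) ∨̇ var (# 1) ≐ var (# 0))) ∧̇
    (¬̇ substitute clusterᶠ (var (# 1) ∷ var (# 2) ∷ var (# 4) ∷ []) ∨̇
     ex< (sucᵗ (var (# 0))) (entry (var (# 4)) (var (# 0)) ≐ var (# 5)))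

module _ (em : ExcludedMiddle 0ℓ) {P : Pred ℕ 0ℓ} where

  open Classical em

  private
    _≺_ : Rel ℕ 0ℓ
    x ≺ y = P ⟪ x , y ⟫

  opaque
    unfolding countsᶠ

    countsᶠ-correct : ∀ {k q m s} → (∀ z → Holds P (k ∷ q ∷ m ∷ s ∷ z ∷ []) countsᶠ) ⇔
                      Counts _≺_ k q m (nth s)
    countsᶠ-correct {k} {q} {m} {s} = mk⇔ forward backward
      where
      resolve : ∀ {Q R : Set} → ¬ Q ⊎ R → Q → R
      resolve (inj₁ ¬q) q = ⊥-elim (¬q q)
      resolve (inj₂ r)  _ = r
      material : ∀ {Q R : Set} → (Q → R) → ¬ Q ⊎ R
      material {Q} f with em {Q}
      ... | yes q = inj₂ (f q)
      ... | no ¬q = inj₁ ¬q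

      forward : (∀ z → Holds P (k ∷ q ∷ m ∷ s ∷ z ∷ []) countsᶠ) → Counts _≺_ k q m (nth s)
      forward h = let (base , members , unique , _) = h 0 in record
        { base    = base
        ; members = members
        ; unique  = λ i i<k j j<k eq → resolve (unique i i<k j j<k) eq
        ; covers  = λ z C → resolve (proj₂ (proj₂ (proj₂ (h z)))) C
        }
      backward : Counts _≺_ k q m (nth s) → ∀ z → Holds P (k ∷ q ∷ m ∷ s ∷ z ∷ []) countsᶠ
      backward (counts base members unique covers) z = base , members ,
        (λ i i<k j j<k → material (unique i i<k j j<k)) , material (covers z)

  -- Lets an arbitrary enumeration of a cluster be replaced by a number coding it, whose decoding
  -- agrees with it on the first `suc k` places only.
  Counts-cong : ∀ {k q m s s'} → (∀ i → i < suc k → s' i ≡ s i) → Counts _≺_ k q m s → Counts _≺_ k q m s'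
  Counts-cong eq (counts base members unique covers) = record
    { base    = base
    ; members = λ i i<k → subst (Cluster _≺_ _ _) (sym (eq i i<k)) (members i i<k)
    ; unique  = λ i i<k j j<k e → unique i i<k j j<k (trans (sym (eq i i<k)) (trans e (eq j j<k)))
    ; covers  = λ z C → let (i , i<k , e) = covers z C in i , i<k , trans (eq i i<k) e
    }

  private
    -- The search input `p` is `⟪ n , ⟪ b , ⟪ q , ⟪ m , s ⟫ ⟫ ⟫ ⟫`: the query `n` followed by the
    -- witness, which begins with the tag `b` of the join.
    number list lower point : ℕ → ℕ
    number p = ⟪ π₁ p , π₁ (π₂ p) ⟫
    lower p  = π₁ (π₂ (π₂ p))
    point p  = π₁ (π₂ (π₂ (π₂ p)))
    list p   = π₂ (π₂ (π₂ (π₂ p)))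

    Test : ℕ → ℕ → Set
    Test p z = Holds P (number p ∷ lower p ∷ point p ∷ list p ∷ z ∷ []) countsᶠ

  clusters⇒≤T-jump : ∀ {A X : Pred ℕ 0ℓ} → P ≤T X → (∀ k → Join A k ⇔ HasCluster _≺_ k) → A ≤T X ′
  clusters⇒≤T-jump {A} {X} P≤X join⇔ = search-join em {D = Test} tester {A} witness⇒join join⇒witness
    where
    testᶠ : Formula 1
    testᶠ = substitute countsᶠ
      (pr (fst p) (fst (snd p)) ∷ fst (snd (snd p)) ∷ fst (snd (snd (snd p))) ∷
       snd (snd (snd (snd p))) ∷ snd (var (# 0)) ∷ [])
      where
      p : Term 1
      p = fst (var (# 0))
    program : (λ x → Holds P (x ∷ []) testᶠ) ≤T X
    program = definable⇒≤T P≤X testᶠ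
    tester : ∀ p z → X ⊢ proj₁ program · ⟪ p , z ⟫ ⇓? Test p z
    tester p z = subst₂ (λ p' z' → X ⊢ proj₁ program · ⟪ p , z ⟫ ⇓? Test p' z') π₁-⟪⟫ π₂-⟪⟫
      (proj₂ program ⟪ p , z ⟫)
    witness⇒join : ∀ {n v} → (∀ z → Test ⟪ n , v ⟫ z) → Join A ⟪ n , π₁ v ⟫
    witness⇒join {n} {v} h = from (join⇔ _) (subst (HasCluster _≺_)
      (cong₂ ⟪_,_⟫ π₁-⟪⟫ (cong π₁ π₂-⟪⟫)) (_ , _ , _ , to countsᶠ-correct h))
    join⇒witness : ∀ {n b} → Join A ⟪ n , b ⟫ → ∃ λ v → ∀ z → Test ⟪ n , v ⟫ z
    join⇒witness {n} {b} j with to (join⇔ _) j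
    ... | q , m , s , C with tabulated s (suc ⟪ n , b ⟫)
    ... | w , eq = v , λ z → holds {⟪ n , v ⟫}
        (cong₂ ⟪_,_⟫ π₁-⟪⟫ (trans (cong π₁ π₂-⟪⟫) π₁-⟪⟫))
        (trans (cong (λ v → π₁ (π₂ v)) π₂-⟪⟫) (trans (cong π₁ π₂-⟪⟫) π₁-⟪⟫))
        (trans (cong (λ v → π₁ (π₂ (π₂ v))) π₂-⟪⟫)
          (trans (cong (λ v → π₁ (π₂ v)) π₂-⟪⟫) (trans (cong π₁ π₂-⟪⟫) π₁-⟪⟫)))
        (trans (cong (λ v → π₂ (π₂ (π₂ v))) π₂-⟪⟫)
          (trans (cong (λ v → π₂ (π₂ v)) π₂-⟪⟫) (trans (cong π₂ π₂-⟪⟫) π₂-⟪⟫)))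
        z
      where
      v : ℕ
      v = ⟪ b , ⟪ q , ⟪ m , w ⟫ ⟫ ⟫
      holds : ∀ {p} → number p ≡ ⟪ n , b ⟫ → lower p ≡ q → point p ≡ m → list p ≡ w → ∀ z → Test p z
      holds e₁ e₂ e₃ e₄ rewrite e₁ | e₂ | e₃ | e₄ = from countsᶠ-correct (Counts-cong eq C)

excluded : ExcludedMiddle 0ℓ → ∀ A → ∃ λ k → ¬ Join A k
excluded em A with em {A 0}
... | yes a = ⟪ 0 , 1 ⟫ , λ where
  (inj₁ (eq , _)) → 1+n≢0 (trans (sym π₂-⟪⟫) eq)
  (inj₂ (_ , ¬a)) → ¬a (subst A (sym π₁-⟪⟫) a)
... | no ¬a = ⟪ 0 , 0 ⟫ , λ where
  (inj₁ (_ , a)) → ¬a (subst A π₁-⟪⟫ a)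
  (inj₂ (nz , _)) → nz π₂-⟪⟫

theorem30 : ExcludedMiddle 0ℓ →
    (A : Pred ℕ 0ℓ) →
    ∃ λ (_≺A_ : Rel ℕ 0ℓ) →
    Irreflexive _≡_ _≺A_ ×
    Interpolable _≺A_ ×
    ((X : Pred ℕ 0ℓ) →
    A ≤T X ′ ⇔
    (∃ λ (_≺_ : Rel ℕ 0ℓ) → X -computable _≺_ × _≺_ ≅ _≺A_))
theorem30 em A =
  _≺A_ , ≺-irreflexive , ≺-interpolable , λ X → mk⇔ (copy X) (decode-copy X)
  where
  B : Blueprint (Join A)
  B = canonical em (excluded em A)
  open Components em B using (component)
  open ForestProperties component using (≺-irreflexive; ≺-interpolable)
  _≺A_ : Rel ℕ 0ℓ
  _≺A_ = Forest component
  copy : ∀ X → A ≤T X ′ → ∃ λ _≺_ → X -computable _≺_ × _≺_ ≅ _≺A_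
  copy X A≤X′ =
    Forest (Components.component em B′) ,
    forest-computable em (joinᶠ em A≤X′) (joinᶠ-correct em A≤X′) (excluded em A) ,
    blueprints-≅ em B′ B
    where
    B′ : Blueprint (Join A)
    B′ = blueprint em (joinᶠ em A≤X′) (joinᶠ-correct em A≤X′) (excluded em A)
  decode-copy : ∀ X → (∃ λ _≺_ → X -computable _≺_ × _≺_ ≅ _≺A_) → A ≤T X ′
  decode-copy X (_≺_ , computable , f , iso) = clusters⇒≤T-jump em computable (λ k → mk⇔
    (λ s → transport-cluster fg gf g-mono f-mono (S⇒cluster em B s))
    (λ C → cluster⇒S em B (transport-cluster gf fg f-mono g-mono C)))
    where
    open IsOrderIsomorphism iso
    g : ℕ → ℕ
    g y = proj₁ (surjective y)
    fg : ∀ y → f (g y) ≡ y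
    fg y = proj₂ (surjective y) refl
    gf : ∀ x → g (f x) ≡ x
    gf x = injective (fg (f x))
    f-mono : ∀ {x y} → π₁ ⟪ x , y ⟫ ≺ π₂ ⟪ x , y ⟫ → f x ≺A f y
    f-mono p = mono (subst₂ _≺_ π₁-⟪⟫ π₂-⟪⟫ p)
    g-mono : ∀ {x y} → x ≺A y → π₁ ⟪ g x , g y ⟫ ≺ π₂ ⟪ g x , g y ⟫
    g-mono {x} {y} p = subst₂ _≺_ (sym π₁-⟪⟫) (sym π₂-⟪⟫)
      (cancel (subst₂ _≺A_ (sym (fg x)) (sym (fg y)) p))
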